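{- For all positive integers $N$ and $Z<N^2$ there exist matrices $A$ and $C$ with $\mathrm{nnz}(A)\le N$, $\mathrm{nnz}(C)\le N$ and $\mathrm{nnz}(AC)\le Z$, such that computing $AC$ in the semiring I/O model requires $\Omega\left(\min\left(\frac{N^2}{MB},\frac{N\sqrt{Z}}{\sqrt{M}\,B}\right)\right)$ I/Os.
   Context: $\mathrm{nnz}(X)$ is the number of nonzero entries of matrix $X$. Semiring I/O model: an internal memory holds $M$ matrix entries (semiring elements, stored with their coordinates), a disk of unbounded size holds the rest, transfers between disk and internal memory happen in blocks of $B$ entries, and the cost is the number of such block transfers (I/Os); semiring elements can only be copied, added and multiplied (no subtraction, division or equality tests), and must be in internal memory to be manipulated. The algorithm must be correct for every semiring (in particular over infinite fields such as the reals) and for arbitrary values of the nonzero input entries; computing $AC$ means producing every nonzero entry of $AC$. -}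

module Defs where

open import Level using (0ℓ)
open import Algebra.Bundles using (Semiring)
open import Data.Bool using (Bool; true; false; if_then_else_; _∧_)
open import Data.Nat using (ℕ; zero; suc; _+_; _*_; _≤_; _≤ᵇ_)
open import Data.Fin using (Fin; toℕ)
open import Data.List using (List; []; _∷_; _++_; length; map; filter; concatMap; take; drop; foldr)
open import Data.List.Base using (allFin)
open import Data.List.Membership.Propositional using (_∈_)
open import Data.Maybe using (Maybe; just; nothing; _>>=_)
open import Data.Product using (Σ; _×_; _,_; ∃)
open import Relation.Binary.PropositionalEquality using (_≡_)
open import Relation.Nullary.Decidable using (does)
open import Function using (_∘_)

-- Sparse matrices: a sparsity pattern.  The nonzero entries get
-- arbitrary values (a valuation) in an arbitrary semiring.

Pattern : ℕ → ℕ → Set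
Pattern n m = Fin n → Fin m → Bool

count : {A : Set} → (A → Bool) → List A → ℕ
count p []       = 0
count p (x ∷ xs) = (if p x then 1 else 0) + count p xs

positions : {n m : ℕ} → Pattern n m → List (Fin n × Fin m)
positions {n} {m} P =
  concatMap (λ i → concatMap (λ j → if P i j then (i , j) ∷ [] else []) (allFin m)) (allFin n)

nnz : {n m : ℕ} → Pattern n m → ℕ
nnz P = length (positions P)

-- structural product pattern: (AC)_{ij} is nonzero iff some k has
-- A_{ik} and C_{kj} nonzero (this is exactly the set of entries that are
-- nonzero for arbitrary values of the nonzero input entries)
anyFin : (m : ℕ) → (Fin m → Bool) → Bool
anyFin m p = foldr (λ k b → if p k then true else b) false (allFin m)

prodPattern : {n m l : ℕ} → Pattern n m → Pattern m l → Pattern n l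
prodPattern {m = m} A C i j = anyFin m (λ k → A i k ∧ C k j)

data Mat : Set where
  matA matC matAC : Mat

module Machine (R : Semiring 0ℓ 0ℓ) where
  open Semiring R using (Carrier)

  record Cell : Set where
    constructor cell
    field
      tag : Mat
      row : ℕ
      col : ℕ
      val : Carrier

  record State : Set where
    constructor state
    field
      mem  : List Cell
      disk : ℕ → List Cell      -- disk, block b holds disk b (≤ B entries)

  at : {A : Set} → List A → ℕ → Maybe A
  at []       _       = nothing
  at (x ∷ xs) zero    = just x
  at (x ∷ xs) (suc k) = at xs k

  removeAt : {A : Set} → List A → ℕ → Maybe (List A)
  removeAt []       _       = nothing
  removeAt (x ∷ xs) zero    = just xs
  removeAt (x ∷ xs) (suc k) = removeAt xs k >>= λ ys → just (x ∷ ys)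

  mapM : {A Bt : Set} → (A → Maybe Bt) → List A → Maybe (List Bt)
  mapM f []       = just []
  mapM f (x ∷ xs) = f x >>= λ y → mapM f xs >>= λ ys → just (y ∷ ys)

-- Instructions (independent of the semiring and of the input values).
-- Memory cells are addressed by their position in the memory list.
data Instr : Set where
  read   : (b : ℕ) → Instr
  write  : (b : ℕ) → (ps : List ℕ) → Instr
  add    : (p q : ℕ) → Mat → (i j : ℕ) → Instr
  mul    : (p q : ℕ) → Mat → (i j : ℕ) → Instr
  copy   : (p : ℕ) → Mat → (i j : ℕ) → Instr
  delete : (p : ℕ) → Instr

Program : Set
Program = List Instr

isIO : Instr → Bool
isIO (read _)    = true
isIO (write _ _) = true
isIO _           = false

cost : Program → ℕ
cost = count isIO

module Exec (R : Semiring 0ℓ 0ℓ) (M B : ℕ) where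
  open Semiring R renaming (_+_ to _⊕_; _*_ to _⊗_)
  open Machine R public

  checkMem : State → Maybe State
  checkMem s = if length (State.mem s) ≤ᵇ M then just s else nothing

  step : Instr → State → Maybe State
  step (read b) (state m d) = checkMem (state (m ++ d b) d)
  step (write b ps) (state m d) =
    if length ps ≤ᵇ B
    then (mapM (at m) ps >>= λ cs →
            just (state m (λ b' → if does (Data.Nat._≟_ b' b) then cs else d b')))
    else nothing
  step (add p q t i j) (state m d) =
    at m p >>= λ x → at m q >>= λ y →
      checkMem (state (m ++ cell t i j (Cell.val x ⊕ Cell.val y) ∷ []) d)
  step (mul p q t i j) (state m d) =
    at m p >>= λ x → at m q >>= λ y →
      checkMem (state (m ++ cell t i j (Cell.val x ⊗ Cell.val y) ∷ []) d)
  step (copy p t i j) (state m d) =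
    at m p >>= λ x → checkMem (state (m ++ cell t i j (Cell.val x) ∷ []) d)
  step (delete p) (state m d) =
    removeAt m p >>= λ m' → just (state m' d)

  trace : Program → State → Maybe (List State)
  trace []       s = just (s ∷ [])
  trace (x ∷ xs) s = step x s >>= λ s' → trace xs s' >>= λ ss → just (s ∷ ss)

  module _ {n m l : ℕ} (A : Pattern n m) (C : Pattern m l)
           (a : Fin n → Fin m → Carrier) (c : Fin m → Fin l → Carrier) where

    inputCells : List Cell
    inputCells =
      map (λ { (i , k) → cell matA (toℕ i) (toℕ k) (a i k) }) (positions A) ++
      map (λ { (k , j) → cell matC (toℕ k) (toℕ j) (c k j) }) (positions C)

    initial : State
    initial = state [] (λ b → take B (drop (b * B) inputCells))

    prodEntry : Fin n → Fin l → Carrier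
    prodEntry i j =
      foldr (λ k s → (if A i k ∧ C k j then a i k ⊗ c k j else 0#) ⊕ s) 0# (allFin m)

    Produces : Program → Set
    Produces P =
      Σ (List State) λ tr → (trace P initial ≡ just tr) ×
        ((i : Fin n) (j : Fin l) → prodPattern A C i j ≡ true →
          Σ State λ s → (s ∈ tr) × Σ Cell λ x → (x ∈ State.mem s) ×
            (Cell.tag x ≡ matAC) × (Cell.row x ≡ toℕ i) × (Cell.col x ≡ toℕ j) ×
            (Cell.val x ≈ prodEntry i j))

Computes : (M B : ℕ) {n m l : ℕ} → Pattern n m → Pattern m l → Program → Set₁
Computes M B A C P =
  (R : Semiring 0ℓ 0ℓ) (a : Fin _ → Fin _ → Semiring.Carrier R)
  (c : Fin _ → Fin _ → Semiring.Carrier R) →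
  Exec.Produces R M B A C a c P

{-# OPTIONS --safe #-}
module Submission where

open import Defs
open import Level using (0ℓ)
open import Algebra.Bundles using (Semiring)
open import Data.Bool using (Bool; true; false; if_then_else_; T)
import Data.Empty as Empty
open import Data.Fin using (Fin; toℕ; _≟_)
open import Data.Fin.Properties using (all?; toℕ-injective)
open import Data.Fin.Subset using (Subset; _∪_; ⁅_⁆; ⊥) renaming (_∈_ to _∈ₛ_)
open import Data.Fin.Subset.Properties
  using (∪-assoc; ∪-comm; ∪-idem; ∪-identityˡ; ∪-identityʳ; x∈p∪q⁻; x∈p∪q⁺; x∈⁅x⁆; x∈⁅y⁆⇒x≡y; ∉⊥)
open import Data.List
  using (List; []; _∷_; _++_; length; map; allFin; cartesianProduct; concatMap; foldr)
open import Data.List.Properties using (length-++; length-map; length-tabulate; length-take)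
import Data.List.Membership.DecPropositional as DecMembership
open import Data.List.Membership.Propositional using (_∈_)
open import Data.List.Membership.Propositional.Properties
  using (∈-++⁺ˡ; ∈-++⁺ʳ; ∈-map⁺; ∈-allFin)
open import Data.List.Relation.Binary.Subset.Propositional using (_⊆_)
open import Data.List.Relation.Unary.All using (All; []; _∷_)
import Data.List.Relation.Unary.All as All
import Data.List.Relation.Unary.All.Properties as Allₚ
open import Data.List.Relation.Unary.AllPairs using ([]; _∷_)
open import Data.List.Relation.Unary.Any using (Any; here; there)
import Data.List.Relation.Unary.Any as Any
open import Data.List.Relation.Unary.Unique.Propositional using (Unique)
open import Data.List.Relation.Unary.Unique.Propositional.Properties
  using (allFin⁺; cartesianProduct⁺)
open import Data.Maybe using (Maybe; just; nothing; _>>=_)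
open import Data.Nat
  using (ℕ; zero; suc; _+_; _*_; _≤_; _<_; _≤ᵇ_; z≤n; s≤s; NonZero; >-nonZero; _<?_)
import Data.Nat as ℕ
open import Data.Nat.DivMod using (_/_; _%_; m/n*n≤m; m≡m%n+[m/n]*n; m%n<n; m≥n⇒m/n>0)
open import Data.Nat.Properties hiding (_≟_)
open import Data.Nat.Tactic.RingSolver using (solve-∀)
open import Data.Product using (Σ; ∃; _×_; _,_; proj₁; proj₂; map₂)
open import Data.Product.Properties using (≡-dec)
open import Data.Sum using (_⊎_; inj₁; inj₂)
import Data.Sum as Sum
open import Data.Unit using (⊤; tt)
open import Function using (_∘_; id)
open import Relation.Binary.Definitions using (DecidableEquality)
open import Relation.Binary.PropositionalEquality
open import Relation.Nullary using (Dec; yes; no; contradiction; does)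
open import Relation.Nullary.Decidable using (map′)

-- A and C are dense, of sizes n × m and m × n with n = ⌊√Z⌋ and m = ⌊N / n⌋.
-- Run the program over a semiring in which a value is an input entry, a
-- partial sum of one entry of AC, or useless. Cut the run into phases of
-- r = ⌊M / B⌋ I/Os; in each phase only O(M) values come in or go out. An
-- elementary product a i k * c k j that is used in the output is formed in a
-- phase that meets both factors, and either a partial sum of entry (i , j)
-- also comes in or goes out in that phase, or the phase computes the entry
-- from scratch. By Loomis–Whitney a phase has O(M√M) products of the first
-- kind; those of the second kind number O(M² / m), because a phase can meet
-- only O(M / m) full rows of A and full columns of C. Comparing with the total
-- of n² m products bounds the number of phases from below. If there are fewer
-- than r I/Os, there is one phase, which starts with empty memory and must
-- read all of A.

-- The semiring

module SemiringOfPartialSums (n m : ℕ) where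

  -- α i k and γ k j tag the entries (i , k) of A and (k , j) of C, and π i j
  -- tags partial sums of entry (i , j) of AC; junk absorbs every value that
  -- cannot occur in a computation of an entry of AC.
  data Tag : Set where
    junk ε : Tag
    α : Fin n → Fin m → Tag
    γ : Fin m → Fin n → Tag
    π : Fin n → Fin n → Tag

  private
    -- An injective code into triples of numbers gives decidable equality without a case for every
    -- pair of constructors.
    encode : Tag → ℕ × ℕ × ℕ
    encode junk    = 0 , 0 , 0
    encode ε       = 1 , 0 , 0
    encode (α i k) = 2 , toℕ i , toℕ k
    encode (γ k j) = 3 , toℕ k , toℕ j
    encode (π i j) = 4 , toℕ i , toℕ j

    pair-injective : ∀ {a b} {i i' : Fin a} {j j' : Fin b} {x} →
      _≡_ {A = ℕ × ℕ × ℕ} (x , toℕ i , toℕ j) (x , toℕ i' , toℕ j') → i ≡ i' × j ≡ j'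
    pair-injective e with cong (λ (_ , y , _) → y) e | cong (λ (_ , _ , z) → z) e
    ... | p | q = toℕ-injective p , toℕ-injective q

    encode-injective : ∀ s t → encode s ≡ encode t → s ≡ t
    encode-injective junk junk e = refl
    encode-injective ε ε e = refl
    encode-injective (α _ _) (α _ _) e with pair-injective e
    ... | refl , refl = refl
    encode-injective (γ _ _) (γ _ _) e with pair-injective e
    ... | refl , refl = refl
    encode-injective (π _ _) (π _ _) e with pair-injective e
    ... | refl , refl = refl

  _≟ᵗ_ : DecidableEquality Tag
  s ≟ᵗ t = map′ (encode-injective s t) (cong encode)
             (≡-dec ℕ._≟_ (≡-dec ℕ._≟_ ℕ._≟_) (encode s) (encode t))

  infixl 6 _∨_
  infixl 7 _·_

  -- Addition of tags is the join of a flat semilattice with `junk` on top; no operation on tags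
  -- leads away from `junk` again.
  _∨_ : Tag → Tag → Tag
  s ∨ t with s ≟ᵗ t
  ... | yes _ = s
  ... | no _  = junk

  ∨-idem : ∀ t → t ∨ t ≡ t
  ∨-idem t with t ≟ᵗ t
  ... | yes _ = refl
  ... | no ¬p = contradiction refl ¬p

  ∨-comm : ∀ s t → s ∨ t ≡ t ∨ s
  ∨-comm s t with s ≟ᵗ t | t ≟ᵗ s
  ... | yes p | yes _ = p
  ... | yes p | no ¬q = contradiction (sym p) ¬q
  ... | no ¬p | yes q = contradiction (sym q) ¬p
  ... | no _  | no _  = refl

  ∨-junkˡ : ∀ t → junk ∨ t ≡ junk
  ∨-junkˡ t with junk ≟ᵗ t
  ... | yes _ = refl
  ... | no _  = refl

  ∨-junkʳ : ∀ t → t ∨ junk ≡ junk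
  ∨-junkʳ t = trans (∨-comm t junk) (∨-junkˡ t)

  ∨-distinct : ∀ {s t} → s ≢ t → s ∨ t ≡ junk
  ∨-distinct {s} {t} s≢t with s ≟ᵗ t
  ... | yes p = contradiction p s≢t
  ... | no _  = refl

  ∨-assoc : ∀ s t u → (s ∨ t) ∨ u ≡ s ∨ (t ∨ u)
  ∨-assoc s t u with s ≟ᵗ t | t ≟ᵗ u
  ... | yes refl | yes refl = refl
  ... | yes refl | no t≢u   = trans (∨-distinct t≢u) (sym (∨-junkʳ s))
  ... | no s≢t   | yes refl = trans (∨-junkˡ u) (sym (∨-distinct s≢t))
  ... | no _     | no _     = trans (∨-junkˡ u) (sym (∨-junkʳ s))

  -- Multiplication is not commutative: apart from the unit `ε`, only an entry of A followed by an
  -- entry of C with the same inner index escapes `junk`.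
  _·_ : Tag → Tag → Tag
  junk    · t       = junk
  ε       · t       = t
  α i k   · γ k' j  with k ≟ k'
  ... | yes _ = π i j
  ... | no _  = junk
  α i k   · ε       = α i k
  α i k   · α _ _   = junk
  α i k   · π _ _   = junk
  α i k   · junk    = junk
  γ k j   · ε       = γ k j
  γ k j   · γ _ _   = junk
  γ k j   · α _ _   = junk
  γ k j   · π _ _   = junk
  γ k j   · junk    = junk
  π i j   · ε       = π i j
  π i j   · γ _ _   = junk
  π i j   · α _ _   = junk
  π i j   · π _ _   = junk
  π i j   · junk    = junk

  ·-identityʳ : ∀ t → t · ε ≡ t
  ·-identityʳ junk    = refl
  ·-identityʳ ε       = refl
  ·-identityʳ (α _ _) = refl
  ·-identityʳ (γ _ _) = refl
  ·-identityʳ (π _ _) = refl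

  ·-junkʳ : ∀ t → t · junk ≡ junk
  ·-junkʳ junk    = refl
  ·-junkʳ ε       = refl
  ·-junkʳ (α _ _) = refl
  ·-junkʳ (γ _ _) = refl
  ·-junkʳ (π _ _) = refl

  -- Once `ε` and `junk` are dealt with, every product of three tags is `junk` in either bracketing.
  -- A case split is needed only where an `α` stands directly before a `γ`.
  ·-assoc : ∀ s t u → (s · t) · u ≡ s · (t · u)
  ·-assoc junk t u = refl
  ·-assoc ε t u = refl
  ·-assoc s ε u = cong (_· u) (·-identityʳ s)
  ·-assoc s t ε = trans (·-identityʳ (s · t)) (cong (s ·_) (sym (·-identityʳ t)))
  ·-assoc s junk u = trans (cong (_· u) (·-junkʳ s)) (sym (·-junkʳ s))
  ·-assoc s t junk =
    trans (·-junkʳ (s · t)) (sym (trans (cong (s ·_) (·-junkʳ t)) (·-junkʳ s)))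
  ·-assoc (α i k) (γ k' j) (α _ _) with k ≟ k'
  ... | yes _ = refl
  ... | no _  = refl
  ·-assoc (α i k) (γ k' j) (γ _ _) with k ≟ k'
  ... | yes _ = refl
  ... | no _  = refl
  ·-assoc (α i k) (γ k' j) (π _ _) with k ≟ k'
  ... | yes _ = refl
  ... | no _  = refl
  ·-assoc (α _ _) (α _ k) (γ k' _) with k ≟ k'
  ... | yes _ = refl
  ... | no _  = refl
  ·-assoc (γ _ _) (α _ k) (γ k' _) with k ≟ k'
  ... | yes _ = refl
  ... | no _  = refl
  ·-assoc (π _ _) (α _ k) (γ k' _) with k ≟ k'
  ... | yes _ = refl
  ... | no _  = refl
  ·-assoc (α _ _) (α _ _) (α _ _) = refl
  ·-assoc (α _ _) (α _ _) (π _ _) = refl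
  ·-assoc (α _ _) (π _ _) (α _ _) = refl
  ·-assoc (α _ _) (π _ _) (γ _ _) = refl
  ·-assoc (α _ _) (π _ _) (π _ _) = refl
  ·-assoc (γ _ _) (α _ _) (α _ _) = refl
  ·-assoc (γ _ _) (α _ _) (π _ _) = refl
  ·-assoc (γ _ _) (γ _ _) (α _ _) = refl
  ·-assoc (γ _ _) (γ _ _) (γ _ _) = refl
  ·-assoc (γ _ _) (γ _ _) (π _ _) = refl
  ·-assoc (γ _ _) (π _ _) (α _ _) = refl
  ·-assoc (γ _ _) (π _ _) (γ _ _) = refl
  ·-assoc (γ _ _) (π _ _) (π _ _) = refl
  ·-assoc (π _ _) (α _ _) (α _ _) = refl
  ·-assoc (π _ _) (α _ _) (π _ _) = refl
  ·-assoc (π _ _) (γ _ _) (α _ _) = refl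
  ·-assoc (π _ _) (γ _ _) (γ _ _) = refl
  ·-assoc (π _ _) (γ _ _) (π _ _) = refl
  ·-assoc (π _ _) (π _ _) (α _ _) = refl
  ·-assoc (π _ _) (π _ _) (γ _ _) = refl
  ·-assoc (π _ _) (π _ _) (π _ _) = refl

  _\\_ : Tag → Tag → Tag
  ε     \\ t     = t
  α _ k \\ π _ j = γ k j
  _     \\ _     = ε

  -- Right quotient, the counterpart of the left quotient above: each recovers one factor from a
  -- product that is not `junk`. The default `ε` is the correct answer when the lost factor is the
  -- unit.
  _//_ : Tag → Tag → Tag
  t     // ε     = t
  π i _ // γ k _ = α i k
  _     // _     = ε

  \\-inverts : ∀ s t → s · t ≡ junk ⊎ s \\ (s · t) ≡ t
  \\-inverts junk t = inj₁ refl
  \\-inverts ε t = inj₂ refl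
  \\-inverts (α i k) (γ k' j) with k ≟ k'
  ... | yes refl = inj₂ refl
  ... | no _     = inj₁ refl
  \\-inverts (α _ _) junk = inj₁ refl
  \\-inverts (α _ _) ε = inj₂ refl
  \\-inverts (α _ _) (α _ _) = inj₁ refl
  \\-inverts (α _ _) (π _ _) = inj₁ refl
  \\-inverts (γ _ _) junk = inj₁ refl
  \\-inverts (γ _ _) ε = inj₂ refl
  \\-inverts (γ _ _) (α _ _) = inj₁ refl
  \\-inverts (γ _ _) (γ _ _) = inj₁ refl
  \\-inverts (γ _ _) (π _ _) = inj₁ refl
  \\-inverts (π _ _) junk = inj₁ refl
  \\-inverts (π _ _) ε = inj₂ refl
  \\-inverts (π _ _) (α _ _) = inj₁ refl
  \\-inverts (π _ _) (γ _ _) = inj₁ refl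
  \\-inverts (π _ _) (π _ _) = inj₁ refl

  //-inverts : ∀ t s → t · s ≡ junk ⊎ (t · s) // s ≡ t
  //-inverts t junk = inj₁ (·-junkʳ t)
  //-inverts t ε = inj₂ (·-identityʳ t)
  //-inverts junk (α _ _) = inj₁ refl
  //-inverts junk (γ _ _) = inj₁ refl
  //-inverts junk (π _ _) = inj₁ refl
  //-inverts ε (α _ _) = inj₂ refl
  //-inverts ε (γ _ _) = inj₂ refl
  //-inverts ε (π _ _) = inj₂ refl
  //-inverts (α i k) (γ k' j) with k ≟ k'
  ... | yes refl = inj₂ refl
  ... | no _     = inj₁ refl
  //-inverts (α _ _) (α _ _) = inj₁ refl
  //-inverts (α _ _) (π _ _) = inj₁ refl
  //-inverts (γ _ _) (α _ _) = inj₁ refl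
  //-inverts (γ _ _) (γ _ _) = inj₁ refl
  //-inverts (γ _ _) (π _ _) = inj₁ refl
  //-inverts (π _ _) (α _ _) = inj₁ refl
  //-inverts (π _ _) (γ _ _) = inj₁ refl
  //-inverts (π _ _) (π _ _) = inj₁ refl

  -- Distinct tags join to junk, so a map that sends junk to junk preserves
  -- joins as soon as it is injective away from the fibre of junk.
  preserves-∨ : (f g : Tag → Tag) → f junk ≡ junk → (∀ t → f t ≡ junk ⊎ g (f t) ≡ t) →
                ∀ t u → f (t ∨ u) ≡ f t ∨ f u
  preserves-∨ f g f-junk g-inverts t u with t ≟ᵗ u
  ... | yes refl = sym (∨-idem (f t))
  ... | no t≢u with f t ≟ᵗ f u
  ...   | no _ = f-junk
  ...   | yes ft≡fu with g-inverts t | g-inverts u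
  ...     | inj₁ p | _      = trans f-junk (sym p)
  ...     | inj₂ _ | inj₁ q = trans f-junk (sym (trans ft≡fu q))
  ...     | inj₂ p | inj₂ q = contradiction (trans (sym p) (trans (cong g ft≡fu) q)) t≢u

  ·-distribˡ-∨ : ∀ s t u → s · (t ∨ u) ≡ s · t ∨ s · u
  ·-distribˡ-∨ s = preserves-∨ (s ·_) (s \\_) (·-junkʳ s) (\\-inverts s)

  ·-distribʳ-∨ : ∀ s t u → (t ∨ u) · s ≡ t · s ∨ u · s
  ·-distribʳ-∨ s = preserves-∨ (_· s) (_// s) refl (λ t → //-inverts t s)

  -- el (π i j) S stands for the sum of a i k * c k j over k ∈ S. For the
  -- other tags S is a bookkeeping artefact that makes both operations
  -- componentwise.
  data Value : Set where
    𝟎  : Value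
    el : Tag → Subset m → Value

  infixl 6 _⊞_
  infixl 7 _⊠_

  _⊞_ : Value → Value → Value
  𝟎      ⊞ y      = y
  el s S ⊞ 𝟎      = el s S
  el s S ⊞ el t T = el (s ∨ t) (S ∪ T)

  _⊠_ : Value → Value → Value
  𝟎      ⊠ y      = 𝟎
  el s S ⊠ 𝟎      = 𝟎
  el s S ⊠ el t T = el (s · t) (S ∪ T)

  ⊞-assoc : ∀ x y z → (x ⊞ y) ⊞ z ≡ x ⊞ (y ⊞ z)
  ⊞-assoc 𝟎 y z = refl
  ⊞-assoc (el _ _) 𝟎 z = refl
  ⊞-assoc (el _ _) (el _ _) 𝟎 = refl
  ⊞-assoc (el s S) (el t T) (el u U) = cong₂ el (∨-assoc s t u) (∪-assoc S T U)

  ⊞-comm : ∀ x y → x ⊞ y ≡ y ⊞ x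
  ⊞-comm 𝟎 𝟎 = refl
  ⊞-comm 𝟎 (el _ _) = refl
  ⊞-comm (el _ _) 𝟎 = refl
  ⊞-comm (el s S) (el t T) = cong₂ el (∨-comm s t) (∪-comm S T)

  ⊞-identityʳ : ∀ x → x ⊞ 𝟎 ≡ x
  ⊞-identityʳ 𝟎 = refl
  ⊞-identityʳ (el _ _) = refl

  ⊠-zeroʳ : ∀ x → x ⊠ 𝟎 ≡ 𝟎
  ⊠-zeroʳ 𝟎 = refl
  ⊠-zeroʳ (el _ _) = refl

  ⊠-assoc : ∀ x y z → (x ⊠ y) ⊠ z ≡ x ⊠ (y ⊠ z)
  ⊠-assoc 𝟎 y z = refl
  ⊠-assoc (el _ _) 𝟎 z = refl
  ⊠-assoc (el _ _) (el _ _) 𝟎 = refl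
  ⊠-assoc (el s S) (el t T) (el u U) = cong₂ el (·-assoc s t u) (∪-assoc S T U)

  ⊠-identityˡ : ∀ x → el ε ⊥ ⊠ x ≡ x
  ⊠-identityˡ 𝟎 = refl
  ⊠-identityˡ (el t T) = cong (el t) (∪-identityˡ T)

  ⊠-identityʳ : ∀ x → x ⊠ el ε ⊥ ≡ x
  ⊠-identityʳ 𝟎 = refl
  ⊠-identityʳ (el t T) = cong₂ el (·-identityʳ t) (∪-identityʳ T)

  -- Union acts on the set components in both addition and multiplication, so distributivity of the
  -- semiring requires it to distribute over itself; idempotence supplies the second copy of `S`.
  ∪-distribˡ-∪ : ∀ (S T U : Subset m) → S ∪ (T ∪ U) ≡ (S ∪ T) ∪ (S ∪ U)
  ∪-distribˡ-∪ S T U = begin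
    S ∪ (T ∪ U)        ≡⟨ cong (_∪ (T ∪ U)) (sym (∪-idem S)) ⟩
    (S ∪ S) ∪ (T ∪ U)  ≡⟨ ∪-assoc S S (T ∪ U) ⟩
    S ∪ (S ∪ (T ∪ U))  ≡⟨ cong (S ∪_) (sym (∪-assoc S T U)) ⟩
    S ∪ ((S ∪ T) ∪ U)  ≡⟨ cong (λ V → S ∪ (V ∪ U)) (∪-comm S T) ⟩
    S ∪ ((T ∪ S) ∪ U)  ≡⟨ cong (S ∪_) (∪-assoc T S U) ⟩
    S ∪ (T ∪ (S ∪ U))  ≡⟨ sym (∪-assoc S T (S ∪ U)) ⟩
    (S ∪ T) ∪ (S ∪ U)  ∎
    where open ≡-Reasoning

  ∪-distribʳ-∪ : ∀ (S T U : Subset m) → (T ∪ U) ∪ S ≡ (T ∪ S) ∪ (U ∪ S)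
  ∪-distribʳ-∪ S T U = begin
    (T ∪ U) ∪ S        ≡⟨ ∪-comm (T ∪ U) S ⟩
    S ∪ (T ∪ U)        ≡⟨ ∪-distribˡ-∪ S T U ⟩
    (S ∪ T) ∪ (S ∪ U)  ≡⟨ cong₂ _∪_ (∪-comm S T) (∪-comm S U) ⟩
    (T ∪ S) ∪ (U ∪ S)  ∎
    where open ≡-Reasoning

  ⊠-distribˡ-⊞ : ∀ x y z → x ⊠ (y ⊞ z) ≡ x ⊠ y ⊞ x ⊠ z
  ⊠-distribˡ-⊞ 𝟎 y z = refl
  ⊠-distribˡ-⊞ (el _ _) 𝟎 z = refl
  ⊠-distribˡ-⊞ (el _ _) (el _ _) 𝟎 = refl
  ⊠-distribˡ-⊞ (el s S) (el t T) (el u U) =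
    cong₂ el (·-distribˡ-∨ s t u) (∪-distribˡ-∪ S T U)

  ⊠-distribʳ-⊞ : ∀ x y z → (y ⊞ z) ⊠ x ≡ y ⊠ x ⊞ z ⊠ x
  ⊠-distribʳ-⊞ x 𝟎 z = refl
  ⊠-distribʳ-⊞ 𝟎 (el _ _) 𝟎 = refl
  ⊠-distribʳ-⊞ 𝟎 (el _ _) (el _ _) = refl
  ⊠-distribʳ-⊞ (el _ _) (el _ _) 𝟎 = refl
  ⊠-distribʳ-⊞ (el s S) (el t T) (el u U) =
    cong₂ el (·-distribʳ-∨ s t u) (∪-distribʳ-∪ S T U)

  semiring : Semiring 0ℓ 0ℓ
  semiring = record
    { Carrier = Value
    ; _≈_ = _≡_
    ; _+_ = _⊞_
    ; _*_ = _⊠_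
    ; 0# = 𝟎
    ; 1# = el ε ⊥
    ; isSemiring = record
      { isSemiringWithoutAnnihilatingZero = record
        { +-isCommutativeMonoid = record
          { isMonoid = record
            { isSemigroup = record
              { isMagma = record { isEquivalence = isEquivalence ; ∙-cong = cong₂ _⊞_ }
              ; assoc = ⊞-assoc
              }
            ; identity = (λ _ → refl) , ⊞-identityʳ
            }
          ; comm = ⊞-comm
          }
        ; *-cong = cong₂ _⊠_
        ; *-assoc = ⊠-assoc
        ; *-identity = ⊠-identityˡ , ⊠-identityʳ
        ; distrib = ⊠-distribˡ-⊞ , ⊠-distribʳ-⊞
        }
      ; zero = (λ _ → refl) , ⊠-zeroʳ
      }
    }

-- Phases of a run

if-just : ∀ {A : Set} {b : Bool} {x y : A} → (if b then just x else nothing) ≡ just y → T b × x ≡ y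
if-just {b = true} refl = tt , refl

if-either : ∀ {A : Set} (P : A → Set) (b : Bool) {x y : A} → P x → P y → P (if b then x else y)
if-either P true  px _  = px
if-either P false _  py = py

>>=-just : ∀ {A B : Set} (x : Maybe A) {f : A → Maybe B} {y} → (x >>= f) ≡ just y →
           ∃ λ a → x ≡ just a × f a ≡ just y
>>=-just (just a) e = a , refl , e

module Phases (n m M B r : ℕ) (1≤r : 1 ≤ r) where

  open SemiringOfPartialSums n m
  open Machine semiring
  open Exec semiring M B using (checkMem; step; trace)

  -- A phase, a run of instructions with at most r I/Os, is represented by the
  -- tags of the values that are in memory at its start or its end, or are
  -- read or written during it.
  Phase : Set
  Phase = List Tag

  tagOf : Value → Tag
  tagOf 𝟎        = junk
  tagOf (el t _) = t

  tags : List Cell → Phase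
  tags = map (tagOf ∘ Cell.val)

  Multiplies : Phase → Fin n → Fin n → Fin m → Set
  Multiplies L i j k = α i k ∈ L × γ k j ∈ L

  -- The phase may contribute the elementary product (i , j , k) to the
  -- output (i , j): it either meets a partial sum of that entry coming from
  -- or going to another phase, or it can compute the entry from scratch.
  Covers : Fin n → Fin n → Fin m → Phase → Set
  Covers i j k L = Multiplies L i j k × (π i j ∈ L ⊎ ∀ k′ → Multiplies L i j k′)

  Covered : List Phase → Fin n → Fin n → Fin m → Set
  Covered Ls i j k = Any (Covers i j k) Ls

  -- The claim about a product inside a partial sum in memory. It was either formed from factors met
  -- in the current phase, or it is inherited from an earlier phase, in which case the partial sum
  -- has come in and its tag is in `L`.
  Pending : Phase → List Phase → Fin n → Fin n → Fin m → Set
  Pending L past i j k = Multiplies L i j k ⊎ (Covered past i j k × π i j ∈ L)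

  -- Arithmetic yields a tag `α` or `γ` only from an operand with that same tag, so such a tag was
  -- in memory when the phase began or was read during it. A `π` can arise inside the phase, so
  -- nothing is asked of it.
  Held : Phase → Tag → Set
  Held L t@(α _ _) = t ∈ L
  Held L t@(γ _ _) = t ∈ L
  Held L _         = ⊤

  -- What k ∈ S means for a value el t S that can arise from the inputs; Φ is
  -- the claim made about the elementary products in a partial sum.
  Justified : (Fin n → Fin n → Fin m → Set) → Tag → Fin m → Set
  Justified Φ junk    k = ⊤
  Justified Φ ε       k = Empty.⊥
  Justified Φ (α _ l) k = k ≡ l
  Justified Φ (γ _ _) k = Empty.⊥
  Justified Φ (π i j) k = Φ i j k

  Valid : (Fin n → Fin n → Fin m → Set) → Value → Set
  Valid Φ 𝟎        = ⊤
  Valid Φ (el t S) = ∀ {k} → k ∈ₛ S → Justified Φ t k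

  InMemory : Phase → List Phase → Value → Set
  InMemory L past v = Valid (Pending L past) v × Held L (tagOf v)

  Justified-map : ∀ {Φ Ψ} t {k} → (∀ {i j} → t ≡ π i j → Φ i j k → Ψ i j k) →
                  Justified Φ t k → Justified Ψ t k
  Justified-map junk    f p = p
  Justified-map (α _ _) f p = p
  Justified-map (π _ _) f p = f refl p

  Valid-map : ∀ {Φ Ψ} v → (∀ {i j k} → tagOf v ≡ π i j → Φ i j k → Ψ i j k) →
              Valid Φ v → Valid Ψ v
  Valid-map 𝟎        f _ = tt
  Valid-map (el t S) f p = λ k∈S → Justified-map t f (p k∈S)

  Held-∈ : ∀ {L} t → t ∈ L → Held L t
  Held-∈ junk    _ = tt
  Held-∈ ε       _ = tt
  Held-∈ (α _ _) p = p
  Held-∈ (γ _ _) p = p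
  Held-∈ (π _ _) _ = tt

  module _ {L L′ : Phase} (L⊆L′ : L ⊆ L′) where

    Held-mono : ∀ t → Held L t → Held L′ t
    Held-mono junk    _ = tt
    Held-mono ε       _ = tt
    Held-mono (α _ _) p = L⊆L′ p
    Held-mono (γ _ _) p = L⊆L′ p
    Held-mono (π _ _) _ = tt

    Multiplies-mono : ∀ {i j k} → Multiplies L i j k → Multiplies L′ i j k
    Multiplies-mono (p , q) = L⊆L′ p , L⊆L′ q

    Covers-mono : ∀ {i j k} → Covers i j k L → Covers i j k L′
    Covers-mono (p , q) = Multiplies-mono p , Sum.map L⊆L′ (Multiplies-mono ∘_) q

    Covered-mono : ∀ {past i j k} → Covered (L ∷ past) i j k → Covered (L′ ∷ past) i j k
    Covered-mono (here p)  = here (Covers-mono p)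
    Covered-mono (there p) = there p

    InMemory-mono : ∀ {past} v → InMemory L past v → InMemory L′ past v
    InMemory-mono v (p , h) =
      Valid-map v (λ _ → Sum.map Multiplies-mono (map₂ L⊆L′)) p , Held-mono (tagOf v) h

  -- Used when a partial sum leaves the phase: its tag is then in `L`, which is what products formed
  -- in this phase still lack. The converse below is used when a partial sum comes in.
  Pending⇒Covered : ∀ {L past i j k} → π i j ∈ L → Pending L past i j k → Covered (L ∷ past) i j k
  Pending⇒Covered π∈L (inj₁ p)       = here (p , inj₁ π∈L)
  Pending⇒Covered π∈L (inj₂ (p , _)) = there p

  Covered⇒Pending : ∀ {L past i j k} → π i j ∈ L → Covered (L ∷ past) i j k → Pending L past i j k
  Covered⇒Pending π∈L (here (p , _)) = inj₁ p
  Covered⇒Pending π∈L (there p)      = inj₂ (p , π∈L)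

  module _ {L : Phase} {past : List Phase} where

    Held-∨ : ∀ s t → Held L s → Held L (s ∨ t)
    Held-∨ s t h with s ≟ᵗ t
    ... | yes _ = h
    ... | no _  = tt

    Justified-∨ : ∀ {Φ} s t {k} → Justified Φ s k ⊎ Justified Φ t k → Justified Φ (s ∨ t) k
    Justified-∨ s t p with s ≟ᵗ t
    ... | yes refl = Sum.reduce p
    ... | no _     = tt

    Held-· : ∀ s t → Held L s → Held L t → Held L (s · t)
    Held-· junk t _ _ = tt
    Held-· ε t _ q = q
    Held-· s@(α _ _) ε p _ = p
    Held-· s@(γ _ _) ε p _ = p
    Held-· (π _ _) ε _ _ = tt
    Held-· (α _ k) (γ k′ _) _ _ with k ≟ k′
    ... | yes _ = tt
    ... | no _  = tt
    Held-· (α _ _) junk _ _ = tt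
    Held-· (α _ _) (α _ _) _ _ = tt
    Held-· (α _ _) (π _ _) _ _ = tt
    Held-· (γ _ _) junk _ _ = tt
    Held-· (γ _ _) (α _ _) _ _ = tt
    Held-· (γ _ _) (γ _ _) _ _ = tt
    Held-· (γ _ _) (π _ _) _ _ = tt
    Held-· (π _ _) junk _ _ = tt
    Held-· (π _ _) (α _ _) _ _ = tt
    Held-· (π _ _) (γ _ _) _ _ = tt
    Held-· (π _ _) (π _ _) _ _ = tt

    -- New products arise only from `α` times `γ`. The set of the left factor contains at most its
    -- own inner index, and both factors are held, so the current phase multiplies them.
    Justified-· : ∀ s t {k} → Held L s → Held L t →
                  let J = Justified (Pending L past) in J s k ⊎ J t k → J (s · t) k
    Justified-· junk t _ _ _ = tt
    Justified-· ε t _ _ (inj₂ q) = q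
    Justified-· (α _ _) ε _ _ (inj₁ p) = p
    Justified-· (γ _ _) ε _ _ (inj₁ ())
    Justified-· (γ _ _) ε _ _ (inj₂ ())
    Justified-· (π _ _) ε _ _ (inj₁ p) = p
    Justified-· (α _ l) (γ l′ _) hα hγ p with l ≟ l′ | p
    ... | yes refl | inj₁ refl = inj₁ (hα , hγ)
    ... | no _     | _         = tt
    Justified-· (α _ _) junk _ _ _ = tt
    Justified-· (α _ _) (α _ _) _ _ _ = tt
    Justified-· (α _ _) (π _ _) _ _ _ = tt
    Justified-· (γ _ _) junk _ _ _ = tt
    Justified-· (γ _ _) (α _ _) _ _ _ = tt
    Justified-· (γ _ _) (γ _ _) _ _ _ = tt
    Justified-· (γ _ _) (π _ _) _ _ _ = tt
    Justified-· (π _ _) junk _ _ _ = tt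
    Justified-· (π _ _) (α _ _) _ _ _ = tt
    Justified-· (π _ _) (γ _ _) _ _ _ = tt
    Justified-· (π _ _) (π _ _) _ _ _ = tt

    InMemory-⊞ : ∀ x y → InMemory L past x → InMemory L past y → InMemory L past (x ⊞ y)
    InMemory-⊞ 𝟎 y _ q = q
    InMemory-⊞ (el _ _) 𝟎 p _ = p
    InMemory-⊞ (el s S) (el t T) (p , hs) (q , _) =
      (λ k∈ → Justified-∨ s t (Sum.map p q (x∈p∪q⁻ S T k∈))) , Held-∨ s t hs

    InMemory-⊠ : ∀ x y → InMemory L past x → InMemory L past y → InMemory L past (x ⊠ y)
    InMemory-⊠ 𝟎 y _ _ = tt , tt
    InMemory-⊠ (el _ _) 𝟎 _ _ = tt , tt
    InMemory-⊠ (el s S) (el t T) (p , hs) (q , ht) =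
      (λ k∈ → Justified-· s t hs ht (Sum.map p q (x∈p∪q⁻ S T k∈))) , Held-· s t hs ht

  -- Access to lists of cells

  at-All : ∀ {P : Cell → Set} {xs p x} → All P xs → at xs p ≡ just x → P x
  at-All {p = zero}  (px ∷ _)  refl = px
  at-All {p = suc _} (_ ∷ pxs) e    = at-All pxs e

  removeAt-All : ∀ {P : Cell → Set} {xs ys} p → All P xs → removeAt xs p ≡ just ys → All P ys
  removeAt-All zero (_ ∷ pxs) refl = pxs
  removeAt-All {xs = _ ∷ xs} (suc p) (px ∷ pxs) e with >>=-just (removeAt xs p) e
  ... | _ , e′ , refl = px ∷ removeAt-All p pxs e′

  removeAt-length : ∀ (xs : List Cell) {ys} p → removeAt xs p ≡ just ys → length ys ≤ length xs
  removeAt-length (_ ∷ xs) zero refl = n≤1+n _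
  removeAt-length (_ ∷ xs) (suc p) e with >>=-just (removeAt xs p) e
  ... | _ , e′ , refl = s≤s (removeAt-length xs p e′)

  mapM-at-All : ∀ {P : Cell → Set} {xs ys} ps → All P xs → mapM (at xs) ps ≡ just ys → All P ys
  mapM-at-All [] _ refl = []
  mapM-at-All {xs = xs} (p ∷ ps) pxs e with >>=-just (at xs p) e
  ... | _ , e₁ , e′ with >>=-just (mapM (at xs) ps) e′
  ...   | _ , e₂ , refl = at-All pxs e₁ ∷ mapM-at-All ps pxs e₂

  mapM-length : ∀ {A : Set} {f : A → Maybe Cell} ps {ys} → mapM f ps ≡ just ys → length ys ≡ length ps
  mapM-length [] refl = refl
  mapM-length {f = f} (p ∷ ps) e with >>=-just (f p) e
  ... | _ , e₁ , e′ with >>=-just (mapM f ps) e′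
  ...   | _ , e₂ , refl = cong suc (mapM-length ps e₂)

  -- The log of phases and its invariant

  record Log : Set where
    constructor mkLog
    field
      past    : List Phase
      current : Phase
      ios     : ℕ
    phases : List Phase
    phases = current ∷ past
    -- All I/Os so far: a phase is closed only after exactly `r` of them.
    total : ℕ
    total = ios + r * length past

  open Log

  -- The first phase starts with empty memory, hence no summand `M` in `first-size`. The second `M`
  -- in `past-size` pays for the memory contents recorded when a phase is closed.
  record Bounded (ℓ : Log) : Set where
    field
      current-size : length (current ℓ) ≤ M + ios ℓ * B
      first-size   : past ℓ ≡ [] → length (current ℓ) ≤ ios ℓ * B
      past-size    : All (λ L → length L ≤ M + r * B + M) (past ℓ)
      ios≤r        : ios ℓ ≤ r

  open Bounded

  -- A partial sum on disk has been written, so its products are already covered; in memory they may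
  -- still be pending.
  record Invariant (ℓ : Log) (s : State) : Set where
    constructor invariant
    open State s
    field
      bounded   : Bounded ℓ
      mem-size  : length mem ≤ M
      disk-size : ∀ b → length (disk b) ≤ B
      mem-ok    : All (InMemory (current ℓ) (past ℓ) ∘ Cell.val) mem
      disk-ok   : ∀ b → All (Valid (Covered (phases ℓ)) ∘ Cell.val) (disk b)

  open Invariant

  infix 4 _⟶[_]_
  record _⟶[_]_ (ℓ : Log) (w : ℕ) (ℓ′ : Log) : Set where
    constructor advance
    field
      total-+ : total ℓ′ ≡ w + total ℓ
      covered : ∀ {i j k} → Covered (phases ℓ) i j k → Covered (phases ℓ′) i j k

  open _⟶[_]_

  ⟶-refl : ∀ {ℓ} → ℓ ⟶[ 0 ] ℓ
  ⟶-refl = advance refl (λ p → p)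

  ⟶-trans : ∀ {v w ℓ₁ ℓ₂ ℓ₃} → ℓ₁ ⟶[ v ] ℓ₂ → ℓ₂ ⟶[ w ] ℓ₃ → ℓ₁ ⟶[ v + w ] ℓ₃
  ⟶-trans {v} {w} {ℓ₁} (advance e f) (advance e′ f′) = advance
    (trans e′ (trans (cong (w +_) e)
      (trans (sym (+-assoc w v (total ℓ₁))) (cong (_+ total ℓ₁) (+-comm w v)))))
    (f′ ∘ f)

  ∈-tags : ∀ {x cs} → x ∈ cs → tagOf (Cell.val x) ∈ tags cs
  ∈-tags = ∈-map⁺ (tagOf ∘ Cell.val)

  -- The memory contents at the boundary are recorded in both phases, as leaving the old one and as
  -- entering the new one.
  newPhase : Log → State → Log
  newPhase ℓ s = mkLog ((current ℓ ++ tags (State.mem s)) ∷ past ℓ) (tags (State.mem s)) 0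

  newPhase-⟶ : ∀ {ℓ} s → ios ℓ ≡ r → ℓ ⟶[ 0 ] newPhase ℓ s
  newPhase-⟶ {ℓ} s refl = advance (*-suc r (length (past ℓ))) (there ∘ Covered-mono ∈-++⁺ˡ)

  -- Recording memory in the closed phase turns the pending products of every stored partial sum
  -- into covered ones; recording it in the new phase makes them pending there, as inherited
  -- products.
  newPhase-invariant : ∀ {ℓ s} → Invariant ℓ s → Invariant (newPhase ℓ s) s
  newPhase-invariant {ℓ} {s} I = invariant
    (record { current-size = ≤-trans tags-size (m≤m+n M 0)
            ; first-size   = λ ()
            ; past-size    = closed-size ∷ past-size (bounded I)
            ; ios≤r        = z≤n })
    (mem-size I) (disk-size I)
    (All.tabulate λ {x} x∈mem → in-memory x x∈mem (All.lookup (mem-ok I) x∈mem))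
    (λ b → All.map (λ {x} → Valid-map (Cell.val x) λ _ → there ∘ Covered-mono ∈-++⁺ˡ) (disk-ok I b))
    where
    open State s
    open ≤-Reasoning
    tags-size : length (tags mem) ≤ M
    tags-size = ≤-trans (≤-reflexive (length-map _ mem)) (mem-size I)
    closed-size : length (current ℓ ++ tags mem) ≤ M + r * B + M
    closed-size = begin
      length (current ℓ ++ tags mem)             ≡⟨ length-++ (current ℓ) ⟩
      length (current ℓ) + length (tags mem)     ≤⟨ +-mono-≤ (current-size (bounded I)) tags-size ⟩
      M + ios ℓ * B + M                          ≤⟨ +-mono-≤ (+-monoʳ-≤ M (*-monoˡ-≤ B (ios≤r (bounded I)))) ≤-refl ⟩
      M + r * B + M                              ∎
    in-memory : ∀ x → x ∈ mem → InMemory (current ℓ) (past ℓ) (Cell.val x) →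
                InMemory (tags mem) (past (newPhase ℓ s)) (Cell.val x)
    in-memory x x∈mem (p , _) =
      Valid-map (Cell.val x) (λ e q →
        let t∈ = subst (_∈ tags mem) e (∈-tags x∈mem) in
        inj₂ (Pending⇒Covered (∈-++⁺ʳ (current ℓ) t∈)
                (Sum.map (Multiplies-mono ∈-++⁺ˡ) (map₂ ∈-++⁺ˡ) q) , t∈)) p
      , Held-∈ _ (∈-tags x∈mem)

  -- Phases are closed lazily, only when a further I/O would exceed `r`.
  makeRoom : ∀ {ℓ s} → Invariant ℓ s → ∃ λ ℓ′ → Invariant ℓ′ s × ios ℓ′ < r × ℓ ⟶[ 0 ] ℓ′
  makeRoom {ℓ} {s} I with ios ℓ <? r
  ... | yes c<r = ℓ , I , c<r , ⟶-refl
  ... | no c≮r  = newPhase ℓ s , newPhase-invariant I , 1≤r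
                , newPhase-⟶ s (≤-antisym (ios≤r (bounded I)) (≮⇒≥ c≮r))

  transfer : Log → List Cell → Log
  transfer ℓ cs = mkLog (past ℓ) (current ℓ ++ tags cs) (suc (ios ℓ))

  transfer-⟶ : ∀ ℓ cs → ℓ ⟶[ 1 ] transfer ℓ cs
  transfer-⟶ ℓ cs = advance refl (Covered-mono ∈-++⁺ˡ)

  transfer-bounded : ∀ {ℓ} cs → length cs ≤ B → ios ℓ < r → Bounded ℓ → Bounded (transfer ℓ cs)
  transfer-bounded {ℓ} cs cs≤B c<r b = record
    { current-size = begin
        length (current ℓ ++ tags cs)  ≤⟨ grown (current-size b) ⟩
        M + ios ℓ * B + B              ≡⟨ +-assoc M _ B ⟩
        M + (ios ℓ * B + B)            ≡⟨ cong (M +_) (+-comm _ B) ⟩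
        M + (B + ios ℓ * B)            ∎
    ; first-size = λ e → ≤-trans (grown (first-size b e)) (≤-reflexive (+-comm _ B))
    ; past-size  = past-size b
    ; ios≤r      = c<r }
    where
    open ≤-Reasoning
    grown : ∀ {x} → length (current ℓ) ≤ x → length (current ℓ ++ tags cs) ≤ x + B
    grown {x} h = begin
      length (current ℓ ++ tags cs)          ≡⟨ length-++ (current ℓ) ⟩
      length (current ℓ) + length (tags cs)  ≡⟨ cong (length (current ℓ) +_) (length-map _ cs) ⟩
      length (current ℓ) + length cs         ≤⟨ +-mono-≤ h cs≤B ⟩
      x + B                                  ∎

  read-invariant : ∀ {ℓ μ d b} → ios ℓ < r → Invariant ℓ (state μ d) → length (μ ++ d b) ≤ M →
                   Invariant (transfer ℓ (d b)) (state (μ ++ d b) d)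
  read-invariant {ℓ} {μ} {d} {b} c<r I fits = invariant
    (transfer-bounded (d b) (disk-size I b) c<r (bounded I)) fits (disk-size I)
    (Allₚ.++⁺ (All.map (λ {x} → InMemory-mono ∈-++⁺ˡ (Cell.val x)) (mem-ok I))
              (All.tabulate λ {x} x∈ → in-memory x (∈-++⁺ʳ (current ℓ) (∈-tags x∈)) (All.lookup (disk-ok I b) x∈)))
    (λ b′ → All.map (λ {x} → Valid-map (Cell.val x) λ _ → Covered-mono ∈-++⁺ˡ) (disk-ok I b′))
    where
    L′ = current ℓ ++ tags (d b)
    in-memory : ∀ x → tagOf (Cell.val x) ∈ L′ → Valid (Covered (phases ℓ)) (Cell.val x) →
                InMemory L′ (past ℓ) (Cell.val x)
    in-memory x t∈ p =
      Valid-map (Cell.val x) (λ e → Covered⇒Pending (subst (_∈ L′) e t∈) ∘ Covered-mono ∈-++⁺ˡ) p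
      , Held-∈ _ t∈

  -- The written tags join the phase, so pending products of the written partial sums become
  -- covered, as the disk invariant demands.
  write-invariant : ∀ {ℓ μ d b cs} → ios ℓ < r → Invariant ℓ (state μ d) → length cs ≤ B →
    All (InMemory (current ℓ) (past ℓ) ∘ Cell.val) cs →
    Invariant (transfer ℓ cs) (state μ (λ b′ → if does (b′ ℕ.≟ b) then cs else d b′))
  write-invariant {ℓ} {μ} {d} {b} {cs} c<r I cs≤B cs-ok = invariant
    (transfer-bounded cs cs≤B c<r (bounded I)) (mem-size I) size
    (All.map (λ {x} → InMemory-mono ∈-++⁺ˡ (Cell.val x)) (mem-ok I)) ok
    where
    L′ = current ℓ ++ tags cs
    size : ∀ b′ → length (if does (b′ ℕ.≟ b) then cs else d b′) ≤ B
    size b′ = if-either (λ xs → length xs ≤ B) (does (b′ ℕ.≟ b)) cs≤B (disk-size I b′)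
    on-disk : ∀ x → tagOf (Cell.val x) ∈ L′ → InMemory (current ℓ) (past ℓ) (Cell.val x) →
              Valid (Covered (L′ ∷ past ℓ)) (Cell.val x)
    on-disk x t∈ p = Valid-map (Cell.val x) (λ e → Pending⇒Covered (subst (_∈ L′) e t∈))
                       (proj₁ (InMemory-mono ∈-++⁺ˡ (Cell.val x) p))
    ok : ∀ b′ → All (Valid (Covered (L′ ∷ past ℓ)) ∘ Cell.val) (if does (b′ ℕ.≟ b) then cs else d b′)
    ok b′ = if-either (All (Valid (Covered (L′ ∷ past ℓ)) ∘ Cell.val)) (does (b′ ℕ.≟ b))
      (All.tabulate λ {x} x∈ → on-disk x (∈-++⁺ʳ (current ℓ) (∈-tags x∈)) (All.lookup cs-ok x∈))
      (All.map (λ {x} → Valid-map (Cell.val x) λ _ → Covered-mono ∈-++⁺ˡ) (disk-ok I b′))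

  checkMem-just : ∀ {s s′} → checkMem s ≡ just s′ → length (State.mem s) ≤ M × s ≡ s′
  checkMem-just {s} e with if-just {b = length (State.mem s) ≤ᵇ M} e
  ... | fits , s≡s′ = ≤ᵇ⇒≤ _ _ fits , s≡s′

  append-invariant : ∀ {ℓ μ d x s′} → Invariant ℓ (state μ d) →
    InMemory (current ℓ) (past ℓ) (Cell.val x) →
    checkMem (state (μ ++ x ∷ []) d) ≡ just s′ → Invariant ℓ s′
  append-invariant {ℓ} {μ} {d} {x} I p e =
    let fits , eq = checkMem-just {state (μ ++ x ∷ []) d} e in
    subst (Invariant ℓ) eq
      (invariant (bounded I) fits (disk-size I) (Allₚ.++⁺ (mem-ok I) (p ∷ [])) (disk-ok I))

  weight : Instr → ℕ
  weight x = if isIO x then 1 else 0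

  step-invariant : ∀ x {ℓ s s′} → Invariant ℓ s → step x s ≡ just s′ →
                   ∃ λ ℓ′ → Invariant ℓ′ s′ × ℓ ⟶[ weight x ] ℓ′
  step-invariant (read b) {s = state μ d} I e
    with checkMem-just {state (μ ++ d b) d} e | makeRoom I
  ... | fits , refl | ℓ , I′ , c<r , ⟶ℓ =
    transfer ℓ (d b) , read-invariant c<r I′ fits , ⟶-trans ⟶ℓ (transfer-⟶ ℓ (d b))
  step-invariant (write b ps) {s = state μ d} I e with length ps ≤ᵇ B in ps≤B | e
  ... | true | e with >>=-just (mapM (at μ) ps) e | makeRoom I
  ...   | cs , e′ , refl | ℓ , I′ , c<r , ⟶ℓ =
    transfer ℓ cs
    , write-invariant c<r I′
        (subst (_≤ B) (sym (mapM-length ps e′)) (≤ᵇ⇒≤ _ _ (subst T (sym ps≤B) tt)))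
        (mapM-at-All ps (mem-ok I′) e′)
    , ⟶-trans ⟶ℓ (transfer-⟶ ℓ cs)
  step-invariant (add p q _ _ _) {ℓ} {state μ d} I e with >>=-just (at μ p) e
  ... | x , ex , e′ with >>=-just (at μ q) e′
  ...   | y , ey , e″ =
    ℓ , append-invariant I (InMemory-⊞ (Cell.val x) (Cell.val y) (at-All (mem-ok I) ex) (at-All (mem-ok I) ey)) e″ , ⟶-refl
  step-invariant (mul p q _ _ _) {ℓ} {state μ d} I e with >>=-just (at μ p) e
  ... | x , ex , e′ with >>=-just (at μ q) e′
  ...   | y , ey , e″ =
    ℓ , append-invariant I (InMemory-⊠ (Cell.val x) (Cell.val y) (at-All (mem-ok I) ex) (at-All (mem-ok I) ey)) e″ , ⟶-refl
  step-invariant (copy p _ _ _) {ℓ} {state μ d} I e with >>=-just (at μ p) e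
  ... | x , ex , e′ = ℓ , append-invariant I (at-All (mem-ok I) ex) e′ , ⟶-refl
  step-invariant (delete p) {ℓ} {state μ d} I e with >>=-just (removeAt μ p) e
  ... | μ′ , e′ , refl =
    ℓ , invariant (bounded I) (≤-trans (removeAt-length μ p e′) (mem-size I)) (disk-size I)
          (removeAt-All p (mem-ok I) e′) (disk-ok I)
    , ⟶-refl

  open DecMembership _≟ᵗ_ using (_∈?_)

  Full : Fin n → Fin n → Value → Set
  Full i j v = ∃ λ S → v ≡ el (π i j) S × (∀ k → k ∈ₛ S)

  -- If the phase never meets `π i j`, no product of the entry can be inherited. Then all of them
  -- were formed in this phase, which computes the entry from scratch.
  full-covered : ∀ {L past i j v} → InMemory L past v → Full i j v → ∀ k → Covered (L ∷ past) i j k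
  full-covered {L} {past} {i} {j} (p , _) (S , refl , full) k with π i j ∈? L
  ... | yes π∈L = Pending⇒Covered π∈L (p (full k))
  ... | no π∉L  = here (multiplies k , inj₂ multiplies)
    where
    multiplies : ∀ k′ → Multiplies L i j k′
    multiplies k′ with p (full k′)
    ... | inj₁ q         = q
    ... | inj₂ (_ , π∈L) = contradiction π∈L π∉L

  -- An output may be in memory at any moment and vanish later. Coverage is never lost, so what
  -- holds at that moment holds for the final log.
  run : ∀ P {ℓ s tr} → Invariant ℓ s → trace P s ≡ just tr →
        ∃ λ ℓ′ → Bounded ℓ′ × ℓ ⟶[ cost P ] ℓ′ ×
        (∀ {s x i j} → s ∈ tr → x ∈ State.mem s → Full i j (Cell.val x) → ∀ k → Covered (phases ℓ′) i j k)
  run [] {ℓ} I refl = ℓ , bounded I , ⟶-refl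
    , λ { (here refl) x∈ full → full-covered (All.lookup (mem-ok I) x∈) full }
  run (x ∷ P) {ℓ} {s} I e with >>=-just (step x s) e
  ... | s′ , es , e′ with >>=-just (trace P s′) e′ | step-invariant x I es
  ...   | tr , et , refl | ℓ₁ , I₁ , ⟶ℓ₁ with run P I₁ et
  ...     | ℓ₂ , b₂ , ⟶ℓ₂ , out = ℓ₂ , b₂ , ⟶-trans ⟶ℓ₁ ⟶ℓ₂
    , λ { (here refl) x∈ full k → covered ⟶ℓ₂ (covered ⟶ℓ₁ (full-covered (All.lookup (mem-ok I) x∈) full k))
        ; (there s∈) → out s∈ }

-- Counting

open ≤-Reasoning

∑ : {A : Set} → List A → (A → ℕ) → ℕ
∑ []       f = 0
∑ (x ∷ xs) f = f x + ∑ xs f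

module _ {A : Set} where

  ∑-mono : ∀ (xs : List A) {f g} → (∀ x → f x ≤ g x) → ∑ xs f ≤ ∑ xs g
  ∑-mono []       h = z≤n
  ∑-mono (x ∷ xs) h = +-mono-≤ (h x) (∑-mono xs h)

  ∑-cong : ∀ (xs : List A) {f g} → (∀ x → f x ≡ g x) → ∑ xs f ≡ ∑ xs g
  ∑-cong []       h = refl
  ∑-cong (x ∷ xs) h = cong₂ _+_ (h x) (∑-cong xs h)

  ∑-+ : ∀ (xs : List A) f g → ∑ xs (λ x → f x + g x) ≡ ∑ xs f + ∑ xs g
  ∑-+ []       f g = refl
  ∑-+ (x ∷ xs) f g rewrite ∑-+ xs f g = interchange (f x) (g x) (∑ xs f) (∑ xs g)
    where
    interchange : ∀ a b c d → a + b + (c + d) ≡ a + c + (b + d)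
    interchange = solve-∀

  ∑-*ˡ : ∀ (xs : List A) c f → ∑ xs (λ x → c * f x) ≡ c * ∑ xs f
  ∑-*ˡ []       c f = sym (*-zeroʳ c)
  ∑-*ˡ (x ∷ xs) c f rewrite ∑-*ˡ xs c f = sym (*-distribˡ-+ c (f x) (∑ xs f))

  ∑-*ʳ : ∀ (xs : List A) c f → ∑ xs (λ x → f x * c) ≡ ∑ xs f * c
  ∑-*ʳ xs c f = trans (∑-cong xs λ x → *-comm (f x) c) (trans (∑-*ˡ xs c f) (*-comm c _))

  ∑-const : ∀ (xs : List A) c → ∑ xs (λ _ → c) ≡ length xs * c
  ∑-const []       c = refl
  ∑-const (x ∷ xs) c = cong (c +_) (∑-const xs c)

  ∑-∈ : ∀ {xs : List A} {f} → Any (λ x → 1 ≤ f x) xs → 1 ≤ ∑ xs f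
  ∑-∈ {x ∷ xs} {f} (here h)  = ≤-trans h (m≤m+n _ _)
  ∑-∈ {x ∷ xs} {f} (there h) = ≤-trans (∑-∈ h) (m≤n+m _ (f x))

  ∑-bounded : ∀ {xs : List A} {f c} → All (λ x → f x ≤ c) xs → ∑ xs f ≤ length xs * c
  ∑-bounded []       = z≤n
  ∑-bounded (h ∷ hs) = +-mono-≤ h (∑-bounded hs)

  -- Induction on the list; the mixed term of the expanded square is bounded summand by summand with
  -- the inequality of arithmetic and geometric means.
  cauchy-schwarz : ∀ (xs : List A) (f g : A → ℕ) →
    let x = ∑ xs λ a → f a * g a in x * x ≤ ∑ xs (λ a → f a * f a) * ∑ xs (λ a → g a * g a)
  cauchy-schwarz [] f g = z≤n
  cauchy-schwarz (a ∷ xs) f g = begin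
    (u * v + P) * (u * v + P)                          ≡⟨ expand (u * v) P ⟩
    u * v * (u * v) + (2 * (P * (u * v)) + P * P)      ≤⟨ +-monoʳ-≤ (u * v * (u * v))
                                                            (+-mono-≤ (cross xs) (cauchy-schwarz xs f g)) ⟩
    u * v * (u * v) + (F * (v * v) + u * u * G + F * G) ≡⟨ factor u v F G ⟩
    (u * u + F) * (v * v + G)                          ∎
    where
    u = f a
    v = g a
    P = ∑ xs λ b → f b * g b
    F = ∑ xs λ b → f b * f b
    G = ∑ xs λ b → g b * g b
    expand : ∀ x y → (x + y) * (x + y) ≡ x * x + (2 * (y * x) + y * y)
    expand = solve-∀
    factor : ∀ u v F G → u * v * (u * v) + (F * (v * v) + u * u * G + F * G) ≡ (u * u + F) * (v * v + G)
    factor = solve-∀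
    -- Lowering both arguments by one lowers both sides by the same amount, so induction avoids
    -- truncated subtraction.
    am-gm : ∀ x y → 2 * (x * y) ≤ x * x + y * y
    am-gm zero y = z≤n
    am-gm (suc x) zero = subst (_≤ suc x * suc x + 0) (sym (cong (2 *_) (*-zeroʳ x))) z≤n
    am-gm (suc x) (suc y) = begin
      2 * (suc x * suc y)                   ≡⟨ shift₁ x y ⟩
      2 * (x * y) + (2 * x + 2 * y + 2)     ≤⟨ +-monoˡ-≤ _ (am-gm x y) ⟩
      x * x + y * y + (2 * x + 2 * y + 2)   ≡⟨ shift₂ x y ⟩
      suc x * suc x + suc y * suc y         ∎
      where
      shift₁ : ∀ x y → 2 * (suc x * suc y) ≡ 2 * (x * y) + (2 * x + 2 * y + 2)
      shift₁ = solve-∀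
      shift₂ : ∀ x y → x * x + y * y + (2 * x + 2 * y + 2) ≡ suc x * suc x + suc y * suc y
      shift₂ = solve-∀
    cross : ∀ ys → 2 * (∑ ys (λ b → f b * g b) * (u * v)) ≤
                   ∑ ys (λ b → f b * f b) * (v * v) + u * u * ∑ ys (λ b → g b * g b)
    cross [] = z≤n
    cross (b ∷ ys) = begin
      2 * ((f b * g b + S) * (u * v))                             ≡⟨ split (f b) (g b) S u v ⟩
      2 * ((f b * v) * (u * g b)) + 2 * (S * (u * v))             ≤⟨ +-mono-≤ (am-gm (f b * v) (u * g b)) (cross ys) ⟩
      f b * v * (f b * v) + u * g b * (u * g b) + (X * (v * v) + u * u * Y) ≡⟨ join (f b) (g b) X Y u v ⟩
      (f b * f b + X) * (v * v) + u * u * (g b * g b + Y)         ∎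
      where
      S = ∑ ys λ b → f b * g b
      X = ∑ ys λ b → f b * f b
      Y = ∑ ys λ b → g b * g b
      split : ∀ p q S u v → 2 * ((p * q + S) * (u * v)) ≡ 2 * ((p * v) * (u * q)) + 2 * (S * (u * v))
      split = solve-∀
      join : ∀ p q X Y u v → p * v * (p * v) + u * q * (u * q) + (X * (v * v) + u * u * Y)
                             ≡ (p * p + X) * (v * v) + u * u * (q * q + Y)
      join = solve-∀

  square-∑-bounded : ∀ {xs : List A} {f c} → All (λ x → f x * f x ≤ c) xs →
                     ∑ xs f * ∑ xs f ≤ length xs * length xs * c
  square-∑-bounded {xs} {f} {c} h = begin
    ∑ xs f * ∑ xs f                        ≡⟨ cong₂ _*_ one one ⟩
    ∑ xs (λ x → 1 * f x) * ∑ xs (λ x → 1 * f x) ≤⟨ cauchy-schwarz xs (λ _ → 1) f ⟩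
    ∑ xs (λ _ → 1) * ∑ xs (λ x → f x * f x) ≤⟨ *-mono-≤ (≤-reflexive (trans (∑-const xs 1) (*-identityʳ (length xs)))) (∑-bounded h) ⟩
    length xs * (length xs * c)            ≡⟨ sym (*-assoc (length xs) (length xs) c) ⟩
    length xs * length xs * c              ∎
    where
    one : ∑ xs f ≡ ∑ xs (λ x → 1 * f x)
    one = ∑-cong xs λ x → sym (*-identityˡ (f x))

∑-swap : ∀ {A B : Set} (xs : List A) (ys : List B) (f : A → B → ℕ) →
         ∑ xs (λ x → ∑ ys (f x)) ≡ ∑ ys (λ y → ∑ xs (λ x → f x y))
∑-swap []       ys f = sym (trans (∑-const ys 0) (*-zeroʳ (length ys)))
∑-swap (x ∷ xs) ys f =
  trans (cong (∑ ys (f x) +_) (∑-swap xs ys f)) (sym (∑-+ ys (f x) (λ y → ∑ xs (λ x → f x y))))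

∑-++ : ∀ {A : Set} (xs ys : List A) f → ∑ (xs ++ ys) f ≡ ∑ xs f + ∑ ys f
∑-++ []       ys f = refl
∑-++ (x ∷ xs) ys f = trans (cong (f x +_) (∑-++ xs ys f)) (sym (+-assoc (f x) _ _))

∑-map : ∀ {A B : Set} (g : A → B) xs f → ∑ (map g xs) f ≡ ∑ xs (f ∘ g)
∑-map g []       f = refl
∑-map g (x ∷ xs) f = cong (f (g x) +_) (∑-map g xs f)

∑-cartesianProduct : ∀ {A B : Set} (xs : List A) (ys : List B) f →
                     ∑ (cartesianProduct xs ys) f ≡ ∑ xs (λ x → ∑ ys (λ y → f (x , y)))
∑-cartesianProduct []       ys f = refl
∑-cartesianProduct (x ∷ xs) ys f =
  trans (∑-++ (map (x ,_) ys) _ f) (cong₂ _+_ (∑-map (x ,_) ys f) (∑-cartesianProduct xs ys f))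

∑-product : ∀ {A B : Set} (xs : List A) (ys : List B) f g →
            ∑ (cartesianProduct xs ys) (λ (x , y) → f x * g y) ≡ ∑ xs f * ∑ ys g
∑-product xs ys f g = trans (∑-cartesianProduct xs ys _)
  (trans (∑-cong xs λ x → ∑-*ˡ ys (f x) g) (∑-*ʳ xs (∑ ys g) f))

-- The Iverson bracket.
⟦_⟧ : {P : Set} → Dec P → ℕ
⟦ d ⟧ = if does d then 1 else 0

⟦⟧-≤ : ∀ {P : Set} (d : Dec P) {x} → (P → 1 ≤ x) → ⟦ d ⟧ ≤ x
⟦⟧-≤ (yes p) h = h p
⟦⟧-≤ (no _)  h = z≤n

⟦⟧≤1 : ∀ {P : Set} (d : Dec P) → ⟦ d ⟧ ≤ 1
⟦⟧≤1 d = ⟦⟧-≤ d λ _ → ≤-refl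

≤⟦⟧ : ∀ {P : Set} (d : Dec P) → P → 1 ≤ ⟦ d ⟧
≤⟦⟧ (yes _) _ = ≤-refl
≤⟦⟧ (no ¬p) p = contradiction p ¬p

⟦⟧-square : ∀ {P : Set} (d : Dec P) → ⟦ d ⟧ * ⟦ d ⟧ ≤ ⟦ d ⟧
⟦⟧-square (yes _) = ≤-refl
⟦⟧-square (no _)  = z≤n

module _ {A : Set} (_≟ᴬ_ : (x y : A) → Dec (x ≡ y)) where

  open DecMembership _≟ᴬ_ using (_∈?_)

  -- Induction on `L`: by injectivity and uniqueness, each element of `L` is the image of at most
  -- one element of `xs`.
  ∑-∈?-≤-length : ∀ {X : Set} {f : X → A} → (∀ {x y} → f x ≡ f y → x ≡ y) →
                  ∀ {xs} → Unique xs → ∀ L → ∑ xs (λ x → ⟦ f x ∈? L ⟧) ≤ length L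
  ∑-∈?-≤-length inj {xs} _ [] = ≤-trans (∑-bounded (All.universal (λ _ → z≤n) xs)) (≤-reflexive (*-zeroʳ (length xs)))
  ∑-∈?-≤-length {X} {f} inj {xs} unique (v ∷ L) = begin
    ∑ xs (λ x → ⟦ f x ∈? (v ∷ L) ⟧)                       ≤⟨ ∑-mono xs (λ x → ⟦⟧-≤ (f x ∈? (v ∷ L)) (head-or-tail x)) ⟩
    ∑ xs (λ x → ⟦ f x ≟ᴬ v ⟧ + ⟦ f x ∈? L ⟧)               ≡⟨ ∑-+ xs _ _ ⟩
    ∑ xs (λ x → ⟦ f x ≟ᴬ v ⟧) + ∑ xs (λ x → ⟦ f x ∈? L ⟧)  ≤⟨ +-mono-≤ (once unique) (∑-∈?-≤-length inj unique L) ⟩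
    suc (length L)                                        ∎
    where
    head-or-tail : ∀ x → f x ∈ v ∷ L → 1 ≤ ⟦ f x ≟ᴬ v ⟧ + ⟦ f x ∈? L ⟧
    head-or-tail x (here e)  = ≤-trans (≤⟦⟧ (f x ≟ᴬ v) e) (m≤m+n _ _)
    head-or-tail x (there p) = ≤-trans (≤⟦⟧ (f x ∈? L) p) (m≤n+m _ ⟦ f x ≟ᴬ v ⟧)
    none : ∀ {ys} → All (λ y → f y ≢ v) ys → ∑ ys (λ x → ⟦ f x ≟ᴬ v ⟧) ≤ 0
    none [] = z≤n
    none {y ∷ _} (y≢ ∷ ys≢) with f y ≟ᴬ v
    ... | yes e = contradiction e y≢
    ... | no _  = none ys≢
    once : ∀ {ys} → Unique ys → ∑ ys (λ x → ⟦ f x ≟ᴬ v ⟧) ≤ 1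
    once [] = z≤n
    once {y ∷ ys} (y∉ys ∷ u) with f y ≟ᴬ v
    ... | yes refl = s≤s (none (All.map (λ y≢z e → y≢z (sym (inj e))) y∉ys))
    ... | no _     = once u

-- Here `t` counts triples whose three projections lie in given sets. Cauchy-Schwarz over the pairs
-- (i , j) separates `p`; each fibre count is at most its row sum and at most its column sum, so its
-- square is at most their product.
loomis-whitney : ∀ {I J K : Set} (is : List I) (js : List J) (ks : List K)
  (a : I → K → ℕ) (c : K → J → ℕ) (p : I × J → ℕ) →
  (∀ i k → a i k ≤ 1) → (∀ k j → c k j ≤ 1) → (∀ x → p x * p x ≤ p x) →
  let ijs = cartesianProduct is js
      t   = ∑ ijs (λ x → p x * ∑ ks (λ k → a (proj₁ x) k * c k (proj₂ x)))
  in t * t ≤ ∑ ijs p * (∑ is (λ i → ∑ ks (a i)) * ∑ js (λ j → ∑ ks (λ k → c k j)))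
loomis-whitney is js ks a c p a≤1 c≤1 p²≤p = begin
  ∑ ijs (λ x → p x * y x) * ∑ ijs (λ x → p x * y x)         ≤⟨ cauchy-schwarz ijs p y ⟩
  ∑ ijs (λ x → p x * p x) * ∑ ijs (λ x → y x * y x)         ≤⟨ *-mono-≤ (∑-mono ijs p²≤p) (∑-mono ijs λ x → *-mono-≤ (y≤a x) (y≤c x)) ⟩
  ∑ ijs p * ∑ ijs (λ (i , j) → ∑ ks (a i) * ∑ ks (λ k → c k j)) ≡⟨ cong (∑ ijs p *_) (∑-product is js _ _) ⟩
  ∑ ijs p * (∑ is (λ i → ∑ ks (a i)) * ∑ js (λ j → ∑ ks (λ k → c k j))) ∎
  where
  ijs = cartesianProduct is js
  y = λ x → ∑ ks (λ k → a (proj₁ x) k * c k (proj₂ x))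
  y≤a : ∀ x → y x ≤ ∑ ks (a (proj₁ x))
  y≤a (i , j) = ∑-mono ks λ k → ≤-trans (*-monoʳ-≤ (a i k) (c≤1 k j)) (≤-reflexive (*-identityʳ _))
  y≤c : ∀ x → y x ≤ ∑ ks (λ k → c k (proj₂ x))
  y≤c (i , j) = ∑-mono ks λ k → ≤-trans (*-monoˡ-≤ (c k j) (a≤1 i k)) (≤-reflexive (*-identityˡ _))

-- Elementary products per phase

module Counting (n m M B r : ℕ) (1≤r : 1 ≤ r) where

  open SemiringOfPartialSums n m
  open Phases n m M B r 1≤r
  open DecMembership _≟ᵗ_ using (_∈?_)

  rows : List (Fin n)
  rows = allFin n

  inner : List (Fin m)
  inner = allFin m

  outputs : List (Fin n × Fin n)
  outputs = cartesianProduct rows rows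

  ∑-rows-const : ∀ c → ∑ rows (λ _ → c) ≡ n * c
  ∑-rows-const c = trans (∑-const rows c) (cong (_* c) (length-tabulate {n = n} id))

  ∑-inner-const : ∀ c → ∑ inner (λ _ → c) ≡ m * c
  ∑-inner-const c = trans (∑-const inner c) (cong (_* c) (length-tabulate {n = m} id))

  has : Phase → Tag → ℕ
  has L t = ⟦ t ∈? L ⟧

  ∑-α≤ : ∀ L → ∑ rows (λ i → ∑ inner (λ k → has L (α i k))) ≤ length L
  ∑-α≤ L = subst (_≤ length L) (∑-cartesianProduct rows inner _)
    (∑-∈?-≤-length _≟ᵗ_ {f = λ (i , k) → α i k} (λ { refl → refl })
       (cartesianProduct⁺ (allFin⁺ n) (allFin⁺ m)) L)

  ∑-γ≤ : ∀ L → ∑ rows (λ j → ∑ inner (λ k → has L (γ k j))) ≤ length L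
  ∑-γ≤ L = subst (_≤ length L) (∑-cartesianProduct rows inner _)
    (∑-∈?-≤-length _≟ᵗ_ {f = λ (j , k) → γ k j} (λ { refl → refl })
       (cartesianProduct⁺ (allFin⁺ n) (allFin⁺ m)) L)

  ∑-π≤ : ∀ L → ∑ outputs (λ (i , j) → has L (π i j)) ≤ length L
  ∑-π≤ L = ∑-∈?-≤-length _≟ᵗ_ {f = λ (i , j) → π i j} (λ { refl → refl })
             (cartesianProduct⁺ (allFin⁺ n) (allFin⁺ n)) L

  fullRow? : ∀ L i → Dec (∀ k → α i k ∈ L)
  fullRow? L i = all? λ k → α i k ∈? L

  fullCol? : ∀ L j → Dec (∀ k → γ k j ∈ L)
  fullCol? L j = all? λ k → γ k j ∈? L

  -- The two alternatives of `Covers`, counted separately. An entry with full row and full column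
  -- contributes all its `m` products to `scratch`.
  partial scratch : Phase → ℕ
  partial L = ∑ outputs λ (i , j) → has L (π i j) * ∑ inner (λ k → has L (α i k) * has L (γ k j))
  scratch L = ∑ outputs λ (i , j) → (m * ⟦ fullRow? L i ⟧) * ⟦ fullCol? L j ⟧

  partial-bound : ∀ L → partial L * partial L ≤ length L * (length L * length L)
  partial-bound L = ≤-trans
    (loomis-whitney rows rows inner (λ i k → has L (α i k)) (λ k j → has L (γ k j)) (λ (i , j) → has L (π i j))
      (λ i k → ⟦⟧≤1 (α i k ∈? L)) (λ k j → ⟦⟧≤1 (γ k j ∈? L)) (λ (i , j) → ⟦⟧-square (π i j ∈? L)))
    (*-mono-≤ (∑-π≤ L) (*-mono-≤ (∑-α≤ L) (∑-γ≤ L)))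

  m*full≤ : ∀ {P : Fin m → Set} (P? : ∀ k → Dec (P k)) → m * ⟦ all? P? ⟧ ≤ ∑ inner (λ k → ⟦ P? k ⟧)
  m*full≤ P? = subst (_≤ ∑ inner (λ k → ⟦ P? k ⟧)) (∑-inner-const _)
    (∑-mono inner λ k → ⟦⟧-≤ (all? P?) λ all → ≤⟦⟧ (P? k) (all k))

  -- Each full row or column takes up `m` distinct tags of the phase. The extra factor `m` on the
  -- left avoids a division.
  scratch-bound : ∀ L → scratch L * m ≤ length L * length L
  scratch-bound L = begin
    scratch L * m
      ≡⟨ cong (_* m) (∑-product rows rows _ _) ⟩
    ∑ rows (λ i → m * ⟦ fullRow? L i ⟧) * ∑ rows (λ j → ⟦ fullCol? L j ⟧) * m
      ≡⟨ *-assoc (∑ rows (λ i → m * ⟦ fullRow? L i ⟧)) _ m ⟩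
    ∑ rows (λ i → m * ⟦ fullRow? L i ⟧) * (∑ rows (λ j → ⟦ fullCol? L j ⟧) * m)
      ≡⟨ cong (∑ rows (λ i → m * ⟦ fullRow? L i ⟧) *_)
           (trans (*-comm _ m) (sym (∑-*ˡ rows m (λ j → ⟦ fullCol? L j ⟧)))) ⟩
    ∑ rows (λ i → m * ⟦ fullRow? L i ⟧) * ∑ rows (λ j → m * ⟦ fullCol? L j ⟧)
      ≤⟨ *-mono-≤ (≤-trans (∑-mono rows λ i → m*full≤ (λ k → α i k ∈? L)) (∑-α≤ L))
                  (≤-trans (∑-mono rows λ j → m*full≤ (λ k → γ k j ∈? L)) (∑-γ≤ L)) ⟩
    length L * length L ∎

  coverage : (Fin n × Fin n) × Fin m → Phase → ℕ
  coverage ((i , j) , k) L =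
    has L (π i j) * (has L (α i k) * has L (γ k j)) + ⟦ fullRow? L i ⟧ * ⟦ fullCol? L j ⟧

  1≤coverage : ∀ {i j k L} → Covers i j k L → 1 ≤ coverage ((i , j) , k) L
  1≤coverage {i} {j} {k} {L} ((α∈ , γ∈) , inj₁ π∈) =
    ≤-trans (*-mono-≤ (≤⟦⟧ (π i j ∈? L) π∈) (*-mono-≤ (≤⟦⟧ (α i k ∈? L) α∈) (≤⟦⟧ (γ k j ∈? L) γ∈)))
            (m≤m+n _ _)
  1≤coverage {i} {j} {k} {L} (_ , inj₂ all) =
    ≤-trans (*-mono-≤ (≤⟦⟧ (fullRow? L i) (proj₁ ∘ all)) (≤⟦⟧ (fullCol? L j) (proj₂ ∘ all)))
            (m≤n+m _ (has L (π i j) * (has L (α i k) * has L (γ k j))))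

  ∑-coverage : ∀ L → ∑ (cartesianProduct outputs inner) (λ x → coverage x L) ≡ partial L + scratch L
  ∑-coverage L = trans (∑-cartesianProduct outputs inner _) (trans (∑-cong outputs per-output) (∑-+ outputs _ _))
    where
    per-output : ∀ x → _
    per-output x@(i , j) = trans (∑-+ inner _ _)
      (cong₂ _+_ (∑-*ˡ inner (has L (π i j)) _)
                 (trans (∑-inner-const _) (sym (*-assoc m _ _))))

  -- Double counting of pairs of a product and a phase: each product has positive coverage in some
  -- phase.
  products-bound : ∀ {Ls} → (∀ i j k → Covered Ls i j k) →
                   n * n * m ≤ ∑ Ls partial + ∑ Ls scratch
  products-bound {Ls} cov = begin
    n * n * m                                        ≡⟨ sym number ⟩
    ∑ triples (λ _ → 1)                              ≤⟨ ∑-mono triples (λ ((i , j) , k) → ∑-∈ (Any.map 1≤coverage (cov i j k))) ⟩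
    ∑ triples (λ x → ∑ Ls (coverage x))              ≡⟨ ∑-swap triples Ls coverage ⟩
    ∑ Ls (λ L → ∑ triples (λ x → coverage x L))      ≡⟨ ∑-cong Ls ∑-coverage ⟩
    ∑ Ls (λ L → partial L + scratch L)               ≡⟨ ∑-+ Ls partial scratch ⟩
    ∑ Ls partial + ∑ Ls scratch                      ∎
    where
    triples = cartesianProduct outputs inner
    number : ∑ triples (λ _ → 1) ≡ n * n * m
    number = trans (∑-cartesianProduct outputs inner _) (trans (∑-cong outputs λ _ → ∑-inner-const 1)
      (trans (∑-cartesianProduct rows rows _) (trans (∑-cong rows λ _ → ∑-rows-const _)
      (trans (∑-rows-const _) (arrange n m)))))
      where
      arrange : ∀ n m → n * (n * (m * 1)) ≡ n * n * m
      arrange = solve-∀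

  -- The larger of the two sums accounts for at least half of all products. The second case is
  -- squared so that no root of `W` appears.
  few-phases⇒few-products : ∀ {Ls W} → (∀ i j k → Covered Ls i j k) → All (λ L → length L ≤ W) Ls →
    (n * n * m * m ≤ 2 * (length Ls * (W * W))) ⊎
    ((n * n * m) * (n * n * m) ≤ 4 * (length Ls * length Ls * (W * (W * W))))
  few-phases⇒few-products {Ls} {W} cov sizes with ≤-total X Y | products-bound cov
    where
    X = ∑ Ls partial
    Y = ∑ Ls scratch
  ... | inj₁ X≤Y | G≤ = inj₁ (begin
    n * n * m * m                       ≤⟨ *-monoˡ-≤ m (≤-trans G≤ (+-monoˡ-≤ Y X≤Y)) ⟩
    (Y + Y) * m                         ≡⟨ double Y m ⟩
    2 * (Y * m)                         ≡⟨ cong (2 *_) (sym (∑-*ʳ Ls m scratch)) ⟩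
    2 * ∑ Ls (λ L → scratch L * m)      ≤⟨ *-monoʳ-≤ 2 (∑-bounded (All.map (λ {L} h → ≤-trans (scratch-bound L) (*-mono-≤ h h)) sizes)) ⟩
    2 * (length Ls * (W * W))           ∎)
    where
    Y = ∑ Ls scratch
    double : ∀ y m → (y + y) * m ≡ 2 * (y * m)
    double = solve-∀
  ... | inj₂ Y≤X | G≤ = inj₂ (begin
    (n * n * m) * (n * n * m)           ≤⟨ *-mono-≤ G≤2X G≤2X ⟩
    (X + X) * (X + X)                   ≡⟨ double X ⟩
    4 * (X * X)                         ≤⟨ *-monoʳ-≤ 4 (square-∑-bounded (All.map (λ {L} h → ≤-trans (partial-bound L) (*-mono-≤ h (*-mono-≤ h h))) sizes)) ⟩
    4 * (length Ls * length Ls * (W * (W * W))) ∎)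
    where
    X = ∑ Ls partial
    G≤2X = ≤-trans G≤ (+-monoʳ-≤ X Y≤X)
    double : ∀ x → (x + x) * (x + x) ≡ 4 * (x * x)
    double = solve-∀

-- The dense instance

dense : ∀ n m → Pattern n m
dense n m _ _ = true

length-concatMap-≤ : ∀ {A B : Set} (f : A → List B) {c} → (∀ x → length (f x) ≤ c) →
                     ∀ xs → length (concatMap f xs) ≤ length xs * c
length-concatMap-≤ f h []       = z≤n
length-concatMap-≤ f h (x ∷ xs) =
  ≤-trans (≤-reflexive (length-++ (f x))) (+-mono-≤ (h x) (length-concatMap-≤ f h xs))

nnz≤size : ∀ {n m} (P : Pattern n m) → nnz P ≤ n * m
nnz≤size {n} {m} P = subst (λ x → nnz P ≤ x * m) (length-tabulate {n = n} id)
  (length-concatMap-≤ _ row (allFin n))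
  where
  entry : ∀ i j → length (if P i j then (i , j) ∷ [] else []) ≤ 1
  entry i j with P i j
  ... | true  = ≤-refl
  ... | false = z≤n
  row : ∀ i → _ ≤ m
  row i = ≤-trans (length-concatMap-≤ _ (entry i) (allFin m))
            (≤-reflexive (trans (*-identityʳ _) (length-tabulate {n = m} id)))

prodPattern-dense : ∀ {n m l} → 1 ≤ m → ∀ i j → prodPattern (dense n m) (dense m l) i j ≡ true
prodPattern-dense (s≤s _) i j = refl

module DenseProduct (n m M B r : ℕ) (1≤m : 1 ≤ m) (1≤r : 1 ≤ r) where

  open SemiringOfPartialSums n m
  open Phases n m M B r 1≤r
  open Counting n m M B r 1≤r
  open Machine semiring
  open Exec semiring M B using (trace; inputCells; initial; prodEntry)

  -- Only the entries of A carry the inner index; those of C have the empty set. The product of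
  -- `a i k` and `c k j` then carries exactly the set of `k`.
  a : Fin n → Fin m → Value
  a i k = el (α i k) ⁅ k ⁆

  c : Fin m → Fin n → Value
  c k j = el (γ k j) ⊥

  open DecMembership _≟ᵗ_ using (_∈?_)

  A = dense n m
  C = dense m n

  α·γ : ∀ i j k → α i k · γ k j ≡ π i j
  α·γ i j k with k ≟ k
  ... | yes _ = refl
  ... | no k≢k = contradiction refl k≢k

  prodEntry-full : ∀ i j → Full i j (prodEntry A C a c i j)
  -- At least one summand is needed: the empty sum is `𝟎`, which has no tag `π i j`.
  prodEntry-full i j = all-summands (allFin m) (length-allFin 1≤m) ∈-allFin
    where
    length-allFin : 1 ≤ m → 1 ≤ length (allFin m)
    length-allFin = subst (1 ≤_) (sym (length-tabulate {n = m} id))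
    entry : List (Fin m) → Value
    entry = foldr (λ k s → (a i k ⊠ c k j) ⊞ s) 𝟎
    sum-of : ∀ k ks → ∃ λ S → entry (k ∷ ks) ≡ el (π i j) S × (∀ {l} → l ∈ k ∷ ks → l ∈ₛ S)
    sum-of k [] = ⁅ k ⁆ ∪ ⊥ , cong (λ t → el t (⁅ k ⁆ ∪ ⊥)) (α·γ i j k)
                , λ { (here refl) → x∈p∪q⁺ (inj₁ (x∈⁅x⁆ k)) }
    sum-of k (k′ ∷ ks) with sum-of k′ ks
    ... | S , e , full = (⁅ k ⁆ ∪ ⊥) ∪ S
      , trans (cong ((a i k ⊠ c k j) ⊞_) e)
              (cong (λ t → el t ((⁅ k ⁆ ∪ ⊥) ∪ S)) (trans (cong (_∨ π i j) (α·γ i j k)) (∨-idem (π i j))))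
      , λ { (here refl) → x∈p∪q⁺ (inj₁ (x∈p∪q⁺ (inj₁ (x∈⁅x⁆ k)))) ; (there l∈) → x∈p∪q⁺ (inj₂ (full l∈)) }
    all-summands : ∀ ks → 1 ≤ length ks → (∀ k → k ∈ ks) → Full i j (entry ks)
    all-summands (k ∷ ks) _ complete with sum-of k ks
    ... | S , e , full = S , e , λ l → full (complete l)

  emptyLog : Log
  emptyLog = mkLog [] [] 0

  initial-invariant : Invariant emptyLog (initial A C a c)
  initial-invariant = invariant
    (record { current-size = z≤n ; first-size = λ _ → z≤n ; past-size = [] ; ios≤r = z≤n })
    z≤n
    (λ b → ≤-trans (≤-reflexive (length-take B _)) (m⊓n≤m B _))
    []
    (λ b → Allₚ.take⁺ B (Allₚ.drop⁺ (b * B) inputs-ok))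
    where
    -- No input has a tag `π`, so nothing needs to be covered at the start.
    inputs-ok : All (Valid (Covered ([] ∷ [])) ∘ Cell.val) (inputCells A C a c)
    inputs-ok = Allₚ.++⁺
      (Allₚ.map⁺ (All.universal (λ (i , k) {l} l∈ → x∈⁅y⁆⇒x≡y k l∈) (positions A)))
      (Allₚ.map⁺ (All.universal (λ _ {l} l∈ → ∉⊥ l∈) (positions C)))

  covering-log : ∀ P → Computes M B A C P →
    ∃ λ ℓ → Bounded ℓ × Log.total ℓ ≡ cost P × (∀ i j k → Covered (Log.phases ℓ) i j k)
  covering-log P computes with computes semiring a c
  ... | tr , tr≡ , produced with run P initial-invariant tr≡
  ...   | ℓ , bounded , advance total≡ _ , out = ℓ , bounded
    , trans total≡ (trans (cong (cost P +_) (*-zeroʳ r)) (+-identityʳ (cost P)))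
    , covered
    where
    covered : ∀ i j k → Covered (Log.phases ℓ) i j k
    covered i j with produced i j (prodPattern-dense 1≤m i j)
    ... | s , s∈ , x , x∈ , _ , _ , _ , val≡ =
      out s∈ x∈ (subst (Full i j) (sym val≡) (prodEntry-full i j))

  -- Covering a product demands both factors in the phase, so all entries of A occur in it; the
  -- column of the output is irrelevant and is taken equal to its row.
  single-phase : ∀ {L} → (∀ i j k → Covered (L ∷ []) i j k) → n * m ≤ length L
  single-phase {L} covered = begin
    n * m                                           ≡⟨ sym (trans (∑-rows-const _) (cong (n *_) (trans (∑-inner-const 1) (*-identityʳ m)))) ⟩
    ∑ rows (λ _ → ∑ inner (λ _ → 1))                ≤⟨ ∑-mono rows (λ i → ∑-mono inner (λ k → α-present i k)) ⟩
    ∑ rows (λ i → ∑ inner (λ k → has L (α i k)))    ≤⟨ ∑-α≤ L ⟩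
    length L                                        ∎
    where
    α-present : ∀ i k → 1 ≤ has L (α i k)
    α-present i k with covered i i k
    ... | here ((α∈ , _) , _) = ≤⟦⟧ (α i k ∈? L) α∈

  -- With fewer than `r` I/Os no phase is ever closed; `c * B ≤ M` is recorded so that the square of
  -- `c * B` can later be replaced by `c * M * B`. Otherwise `p` is the number of phases, each of
  -- size at most `3 * M`.
  cost-bound : r * B ≤ M → M ≤ 2 * (r * B) → ∀ P → Computes M B A C P →
    let c = cost P in
    (n * m ≤ c * B × c * B ≤ M) ⊎
    (∃ λ p → p * M ≤ 4 * (c * B) ×
      ((n * n * m * m ≤ 2 * (p * (3 * M * (3 * M)))) ⊎
       ((n * n * m) * (n * n * m) ≤ 4 * (p * p * (3 * M * (3 * M * (3 * M)))))))
  cost-bound rB≤M M≤2rB P computes with covering-log P computes | cost P <? r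
  ... | mkLog [] L ios , b , total≡ , covered | yes c<r = inj₁
    ( ≤-trans (single-phase covered) (subst (λ x → length L ≤ x * B) ios≡c (Bounded.first-size b refl))
    , ≤-trans (*-monoˡ-≤ B (<⇒≤ c<r)) rB≤M)
    where
    ios≡c : ios ≡ cost P
    ios≡c = trans (sym (trans (cong (ios +_) (*-zeroʳ r)) (+-identityʳ ios))) total≡
  -- A closed phase alone accounts for `r` I/Os.
  ... | mkLog (_ ∷ past) L ios , _ , total≡ , _ | yes c<r = contradiction r≤c (<⇒≱ c<r)
    where
    r≤c : r ≤ cost P
    r≤c = begin
      r                              ≤⟨ m≤m+n r _ ⟩
      r + r * length past            ≡⟨ sym (*-suc r (length past)) ⟩
      r * suc (length past)          ≤⟨ m≤n+m _ ios ⟩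
      ios + r * suc (length past)    ≡⟨ total≡ ⟩
      cost P                         ∎
  ... | ℓ@(mkLog past L ios) , b , total≡ , covered | no c≮r = inj₂
    (suc (length past) , few-phases , few-phases⇒few-products covered (current≤3M ∷ All.map past≤3M (Bounded.past-size b)))
    where
    few-phases : suc (length past) * M ≤ 4 * (cost P * B)
    few-phases = begin
      suc (length past) * M                ≤⟨ *-monoʳ-≤ (suc (length past)) M≤2rB ⟩
      suc (length past) * (2 * (r * B))    ≡⟨ arrange (length past) r B ⟩
      -- The open phase may have made fewer than `r` I/Os. It is charged to `r ≤ cost P`, at the
      -- price of another factor 2.
      2 * ((r + r * length past) * B)      ≤⟨ *-monoʳ-≤ 2 (*-monoˡ-≤ B (+-mono-≤ (≮⇒≥ c≮r)
                                                (≤-trans (m≤n+m _ ios) (≤-reflexive total≡)))) ⟩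
      2 * ((cost P + cost P) * B)          ≡⟨ double (cost P) B ⟩
      4 * (cost P * B)                     ∎
      where
      arrange : ∀ p r B → suc p * (2 * (r * B)) ≡ 2 * ((r + r * p) * B)
      arrange = solve-∀
      double : ∀ c B → 2 * ((c + c) * B) ≡ 4 * (c * B)
      double = solve-∀
    triple : M + M + M ≡ 3 * M
    triple = three M
      where
      three : ∀ M → M + M + M ≡ 3 * M
      three = solve-∀
    past≤3M : ∀ {x} → x ≤ M + r * B + M → x ≤ 3 * M
    past≤3M h = ≤-trans h (≤-trans (+-monoˡ-≤ M (+-monoʳ-≤ M rB≤M)) (≤-reflexive triple))
    current≤3M : length L ≤ 3 * M
    current≤3M = past≤3M (≤-trans (Bounded.current-size b)
      (≤-trans (+-monoʳ-≤ M (*-monoˡ-≤ B (Bounded.ios≤r b))) (m≤m+n _ M)))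

-- Rounding and constants

square-root : ∀ Z → ∃ λ q → q * q ≤ Z × Z < suc q * suc q
square-root zero = 0 , z≤n , s≤s z≤n
square-root (suc Z) with square-root Z
... | q , q²≤Z , Z<q′² with suc Z <? suc q * suc q
...   | yes h = q , m≤n⇒m≤1+n q²≤Z , h
...   | no h  = suc q , ≮⇒≥ h , ≤-<-trans Z<q′² (*-mono-< (n<1+n (suc q)) (n<1+n (suc q)))

assoc₄ : ∀ k c M B → k * (c * M * B) ≡ k * c * M * B
assoc₄ = solve-∀

-- The numerical constants of the next three lemmas are kept as variables,
-- since large literals are unfolded in unary during type checking.

single-phase-cost : ∀ a K {N M B c X} → a * a ≤ K → N ≤ a * X → X ≤ c * B → c * B ≤ M →
                    N * N ≤ K * c * M * B
single-phase-cost a K {N} {M} {B} {c} {X} a²≤K N≤aX X≤cB cB≤M = begin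
  N * N                        ≤⟨ *-mono-≤ N≤acB N≤acB ⟩
  a * (c * B) * (a * (c * B))  ≤⟨ *-monoʳ-≤ (a * (c * B)) (*-monoʳ-≤ a cB≤M) ⟩
  a * (c * B) * (a * M)        ≡⟨ arrange a c B M ⟩
  a * a * (c * M * B)          ≤⟨ *-monoˡ-≤ (c * M * B) a²≤K ⟩
  K * (c * M * B)              ≡⟨ assoc₄ K c M B ⟩
  K * c * M * B                ∎
  where
  N≤acB : N ≤ a * (c * B)
  N≤acB = ≤-trans N≤aX (*-monoʳ-≤ a X≤cB)
  arrange : ∀ a c B M → a * (c * B) * (a * M) ≡ a * a * (c * M * B)
  arrange = solve-∀

-- Here `a` is the loss from rounding, `b` comes from the product count, `w` is the phase size in
-- units of `M`, and `l` relates the number of phases to the cost; likewise in `partial-cost`.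
scratch-cost : ∀ a b w l K {p M B c X} → a * (b * (w * w)) * l ≤ K → p * M ≤ l * (c * B) →
               X ≤ b * (p * (w * M * (w * M))) → a * X ≤ K * c * M * B
scratch-cost a b w l K {p} {M} {B} {c} {X} const≤K pM≤ X≤ = begin
  a * X                                    ≤⟨ *-monoʳ-≤ a X≤ ⟩
  a * (b * (p * (w * M * (w * M))))        ≡⟨ arrange a b w p M ⟩
  a * (b * (w * w)) * M * (p * M)          ≤⟨ *-monoʳ-≤ (a * (b * (w * w)) * M) pM≤ ⟩
  a * (b * (w * w)) * M * (l * (c * B))    ≡⟨ regroup (a * (b * (w * w))) l c M B ⟩
  a * (b * (w * w)) * l * (c * M * B)      ≤⟨ *-monoˡ-≤ (c * M * B) const≤K ⟩
  K * (c * M * B)                          ≡⟨ assoc₄ K c M B ⟩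
  K * c * M * B                            ∎
  where
  arrange : ∀ a b w p M → a * (b * (p * (w * M * (w * M)))) ≡ a * (b * (w * w)) * M * (p * M)
  arrange = solve-∀
  regroup : ∀ k l c M B → k * M * (l * (c * B)) ≡ k * l * (c * M * B)
  regroup = solve-∀

partial-cost : ∀ a b w l K {p M B c X} → a * (b * (w * (w * w))) * (l * l) ≤ K * K → p * M ≤ l * (c * B) →
               X ≤ b * (p * p * (w * M * (w * M * (w * M)))) → a * X ≤ K * K * (c * c) * M * (B * B)
partial-cost a b w l K {p} {M} {B} {c} {X} const≤K² pM≤ X≤ = begin
  a * X
    ≤⟨ *-monoʳ-≤ a X≤ ⟩
  a * (b * (p * p * (w * M * (w * M * (w * M)))))
    ≡⟨ arrange a b w p M ⟩
  a * (b * (w * (w * w))) * (p * M * (p * M) * M)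
    ≤⟨ *-monoʳ-≤ (a * (b * (w * (w * w)))) (*-monoˡ-≤ M (*-mono-≤ pM≤ pM≤)) ⟩
  a * (b * (w * (w * w))) * (l * (c * B) * (l * (c * B)) * M)
    ≡⟨ regroup (a * (b * (w * (w * w)))) l c B M ⟩
  a * (b * (w * (w * w))) * (l * l) * (c * c * M * (B * B))
    ≤⟨ *-monoˡ-≤ (c * c * M * (B * B)) const≤K² ⟩
  K * K * (c * c * M * (B * B))
    ≡⟨ assoc₄ (K * K) (c * c) M (B * B) ⟩
  K * K * (c * c) * M * (B * B) ∎
  where
  arrange : ∀ a b w p M → a * (b * (p * p * (w * M * (w * M * (w * M))))) ≡
                          a * (b * (w * (w * w))) * (p * M * (p * M) * M)
  arrange = solve-∀
  regroup : ∀ k l c B M → k * (l * (c * B) * (l * (c * B)) * M) ≡ k * (l * l) * (c * c * M * (B * B))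
  regroup = solve-∀

≤2*quotient : ∀ x y .{{_ : NonZero y}} → 1 ≤ x / y → x ≤ 2 * (x / y * y)
≤2*quotient x y 1≤x/y = begin
  x                          ≡⟨ m≡m%n+[m/n]*n x y ⟩
  x % y + x / y * y          ≤⟨ +-monoˡ-≤ _ (<⇒≤ (m%n<n x y)) ⟩
  y + x / y * y              ≡⟨ cong (_+ x / y * y) (sym (*-identityˡ y)) ⟩
  1 * y + x / y * y          ≤⟨ +-monoˡ-≤ _ (*-monoˡ-≤ y 1≤x/y) ⟩
  x / y * y + x / y * y      ≡⟨ cong (x / y * y +_) (sym (+-identityʳ _)) ⟩
  2 * (x / y * y)            ∎

module _ (K : ℕ) (4≤K : 2 * 2 ≤ K) (const≤K : 4 * (2 * (3 * 3)) * 4 ≤ K)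
         (const≤K² : 16 * (4 * (3 * (3 * 3))) * (4 * 4) ≤ K * K) where

  hard-instance : (N Z M B : ℕ) → 1 ≤ N → Z < N * N → 1 ≤ B → B ≤ M →
    Σ ℕ λ n → Σ ℕ λ m → Σ ℕ λ l →
    Σ (Pattern n m) λ A → Σ (Pattern m l) λ C →
    (nnz A ≤ N) × (nnz C ≤ N) × (nnz (prodPattern A C) ≤ Z) ×
    ((P : Program) → Computes M B A C P →
    (N * N ≤ K * cost P * M * B)
    ⊎ (N * N * Z ≤ K * K * (cost P * cost P) * M * (B * B)))
  -- For `Z = 0` the second alternative is trivial, so empty matrices suffice.
  hard-instance N zero M B _ _ _ _ = 0 , 0 , 0 , (λ ()) , (λ ()) , z≤n , z≤n , z≤n
    , λ P _ → inj₂ (subst (_≤ K * K * (cost P * cost P) * M * (B * B)) (sym (*-zeroʳ (N * N))) z≤n)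
  hard-instance N Z@(suc _) M B 1≤N Z<N² 1≤B B≤M with square-root Z
  ... | zero , _ , s≤s ()
  ... | n@(suc _) , n²≤Z , Z<sn² =
    n , m , n , dense n m , dense m n
    , ≤-trans (nnz≤size (dense n m)) nm≤N
    , ≤-trans (nnz≤size (dense m n)) (m/n*n≤m N n)
    , ≤-trans (nnz≤size (prodPattern (dense n m) (dense m n))) n²≤Z
    , bound
    where
    instance
      B≢0 : NonZero B
      B≢0 = >-nonZero 1≤B
    m = N / n
    r = M / B
    -- From `n * n ≤ Z < N * N`; this makes the inner dimension `m` positive.
    n≤N : n ≤ N
    n≤N = ≮⇒≥ λ N<n → <⇒≱ Z<N² (≤-trans (*-mono-≤ (<⇒≤ N<n) (<⇒≤ N<n)) n²≤Z)
    1≤m : 1 ≤ m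
    1≤m = m≥n⇒m/n>0 n≤N
    1≤r : 1 ≤ r
    1≤r = m≥n⇒m/n>0 B≤M
    nm≤N : n * m ≤ N
    nm≤N = subst (_≤ N) (*-comm m n) (m/n*n≤m N n)
    N≤2nm : N ≤ 2 * (n * m)
    N≤2nm = subst (λ x → N ≤ 2 * x) (*-comm m n) (≤2*quotient N n 1≤m)
    N²≤ : N * N ≤ 4 * (n * n * m * m)
    N²≤ = ≤-trans (*-mono-≤ N≤2nm N≤2nm) (≤-reflexive (square n m))
      where
      square : ∀ n m → 2 * (n * m) * (2 * (n * m)) ≡ 4 * (n * n * m * m)
      square = solve-∀
    Z≤4n² : Z ≤ 4 * (n * n)
    Z≤4n² = begin
      Z                  ≤⟨ <⇒≤ Z<sn² ⟩
      suc n * suc n      ≤⟨ *-mono-≤ sn≤2n sn≤2n ⟩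
      2 * n * (2 * n)    ≡⟨ arrange n ⟩
      4 * (n * n)        ∎
      where
      sn≤2n : suc n ≤ 2 * n
      sn≤2n = +-mono-≤ {1} (s≤s z≤n) (≤-reflexive (sym (+-identityʳ n)))
      arrange : ∀ n → 2 * n * (2 * n) ≡ 4 * (n * n)
      arrange = solve-∀
    N²Z≤ : N * N * Z ≤ 16 * ((n * n * m) * (n * n * m))
    N²Z≤ = ≤-trans (*-mono-≤ N²≤ Z≤4n²) (≤-reflexive (arrange 4 n m))
      where
      arrange : ∀ a n m → a * (n * n * m * m) * (a * (n * n)) ≡ a * a * ((n * n * m) * (n * n * m))
      arrange = solve-∀

    bound : (P : Program) → Computes M B (dense n m) (dense m n) P →
            (N * N ≤ K * cost P * M * B) ⊎ (N * N * Z ≤ K * K * (cost P * cost P) * M * (B * B))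
    bound P computes
      with DenseProduct.cost-bound n m M B r 1≤m 1≤r (m/n*n≤m M B) (≤2*quotient M B 1≤r) P computes
    ... | inj₁ (nm≤cB , cB≤M)      = inj₁ (single-phase-cost 2 K 4≤K N≤2nm nm≤cB cB≤M)
    ... | inj₂ (p , pM≤ , inj₁ h) = inj₁ (≤-trans N²≤ (scratch-cost 4 2 3 4 K {p} {B = B} {c = cost P} const≤K pM≤ h))
    ... | inj₂ (p , pM≤ , inj₂ h) = inj₂ (≤-trans N²Z≤ (partial-cost 16 4 3 4 K {p} {B = B} {c = cost P} const≤K² pM≤ h))

theorem2 : Σ ℕ λ K → (1 ≤ K) ×
    ((N Z M B : ℕ) → 1 ≤ N → Z < N * N → 1 ≤ B → B ≤ M →
    Σ ℕ λ n → Σ ℕ λ m → Σ ℕ λ l →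
    Σ (Pattern n m) λ A → Σ (Pattern m l) λ C →
    (nnz A ≤ N) × (nnz C ≤ N) × (nnz (prodPattern A C) ≤ Z) ×
    ((P : Program) → Computes M B A C P →
    (N * N ≤ K * cost P * M * B)
    ⊎ (N * N * Z ≤ K * K * (cost P * cost P) * M * (B * B))))
-- 288 = 4 · (2 · 3²) · 4 is exactly the constant of the from-scratch case. The partial-sum case
-- needs 16 · (4 · 3³) · 4² = 27648, which is below 288² = 82944.
theorem2 = 288 , ≤ᵇ⇒≤ 1 288 tt
  , hard-instance 288 (≤ᵇ⇒≤ 4 288 tt) (≤ᵇ⇒≤ 288 288 tt) (≤ᵇ⇒≤ 27648 82944 tt)
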